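{- For $j=1,6$ and every $n\ge 1$ the genus distribution of ${\cal S}_j^n$ is log-concave. Moreover, writing $p_j(n)$ for the peak of the genus distribution of ${\cal S}_j^n$, one has $$p_1(n)=\Big[\frac{n+1}{3}\Big]\quad\text{if } n\ge 1 \text{ and } n\ne 2,$$ and $$p_6(n)=\Big[\frac{n+2}{3}\Big]\quad\text{if } n\ge 2.$$
   Context: $[x]$ denotes the largest integer not exceeding $x$. A surface is represented by a cyclic word in which every occurring letter $x$ appears exactly once as $x$ and exactly once as $x^-$; it is the closed orientable surface obtained from a polygon with boundary labelled by the word by identifying each side $x$ with the side $x^-$ (orientation reversed), and its genus is the genus of that surface. Let $a,a_1,a_2,\dots$ be distinct letters. For $n\ge 1$ and subsets $K,T\subseteq\{1,\dots,n\}$ put: $R_1^n$ = product of the letters $a_k$, $k\in K$, in decreasing order of index; $R_2^n$ = product of the $a_k$, $k\notin K$, in increasing order of index; $R_3^n$ = product of the $a_t^-$, $t\in T$, in decreasing order of index; $R_4^n$ = product of the $a_t^-$, $t\notin T$, in increasing order of index. The sets of ladder surfaces considered are ${\cal S}_1^n=\{R_1^nR_2^nR_3^nR_4^n\}$ and ${\cal S}_6^n=\{aR_1^nR_4^na^-R_2^nR_3^n\}$, where $(K,T)$ runs over all $4^n$ pairs of subsets and surfaces are counted with multiplicity (one for each pair). $g_{i_j}(n)$ is the number of surfaces of genus $i$ in ${\cal S}_j^n$, and the genus distribution of ${\cal S}_j^n$ is the sequence $g_{\gamma_j}(n),g_{\gamma_j+1}(n),\dots,g_{\gamma_{M_j}}(n)$,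 where $\gamma_j$ and $\gamma_{M_j}$ are the minimum and maximum genus of surfaces in ${\cal S}_j^n$. A finite sequence of nonnegative numbers is log-concave if $a_i^2\ge a_{i-1}a_{i+1}$ for all interior indices $i$. It is unimodal if $a_q\le\cdots\le a_{l-1}<a_l=\cdots=a_m>a_{m+1}\ge\cdots\ge a_n$ for some $q\le l\le m\le n$; $l,\dots,m$ are its modes, and if $l=m$ then $m$ is called the peak (indices are genera). -}

module Defs where

open import Data.Bool using (if_then_else_)
open import Data.Fin using (Fin; toℕ)
open import Data.Fin.Subset using (Subset; inside; outside; ∁)
open import Data.Fin.Subset.Properties using (_∈?_)
open import Data.List
  using (List; []; _∷_; [_]; _++_; map; length; reverse; filter; zip;
         allFin; deduplicate; cartesianProductWith)
open import Data.List.Membership.Propositional using (_∈_)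
open import Data.List.Relation.Unary.All using (All)
open import Data.List.Relation.Unary.Any using (here; there)
open import Data.Nat using (ℕ; suc; _∸_; _/_; _*_; _≤_; _<_)
import Data.Nat.Properties as ℕ
open import Data.Product using (_×_; _,_; ∃₂)
open import Data.Product.Properties using (≡-dec)
open import Data.Sign using (Sign; +; -; opposite)
import Data.Sign.Properties as Sign
import Data.Vec as Vec
open import Function using (_∘_; id; _⇔_; mk⇔)
open import Relation.Binary.Construct.Closure.Equivalence as EqC using (EqClosure)
open import Relation.Binary.Definitions using (DecidableEquality)
open import Relation.Binary.PropositionalEquality
  using (_≡_; refl; cong; subst; isEquivalence)
open import Relation.Nullary using (yes; no; does; contradiction)

-- The letter a is 0 and a_k is k for k ≥ 1.  (x , +) is the side x of the
-- polygon and (x , -) is the side x⁻.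
Side : Set
Side = ℕ × Sign

_≟ˢ_ : DecidableEquality Side
_≟ˢ_ = ≡-dec ℕ._≟_ Sign._≟_

inverse : Side → Side
inverse (x , s) = x , opposite s

-- A word is read cyclically.  It represents a surface when every letter x
-- occurring in it occurs exactly once as x and exactly once as x⁻.
Word : Set
Word = List Side

-- In a word representing a surface, every corner of the polygon is named by
-- the unique side that starts there.  If s is cyclically followed by t, then
-- s ends at the corner t, and gluing s to s⁻ with reversed orientation
-- identifies the end of s with the start of s⁻, i.e. the corner t with the
-- corner inverse s.  Taking s to be x and then x⁻ covers both ends of an edge.
gluings : Word → List (Side × Side)
gluings []      = []
gluings (s ∷ w) = zip (map inverse (s ∷ w)) (w ++ [ s ])

Glued : Word → Side → Side → Set
Glued w s t = (s , t) ∈ gluings w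

SameVertex : Word → Side → Side → Set
SameVertex w = EqClosure (Glued w)

-- label ps computes the quotient of Side by the equivalence relation
-- generated by the pairs in ps: two sides are equivalent exactly when their
-- labels agree (label-correct).
merge : Side × Side → (Side → Side) → Side → Side
merge (s , t) c x = if does (c x ≟ˢ c s) then c t else c x

label : List (Side × Side) → Side → Side
label []       = id
label (p ∷ ps) = merge p (label ps)

private
  Rel : List (Side × Side) → Side → Side → Set
  Rel ps s t = (s , t) ∈ ps

  label-sound : ∀ ps x → EqClosure (Rel ps) x (label ps x)
  label-sound []             x = EqC.reflexive _
  label-sound ((s , t) ∷ ps) x with label ps x ≟ˢ label ps s
  ... | no  _  = EqC.map there (label-sound ps x)
  ... | yes eq =
    EqC.transitive _ (EqC.map there (subst (EqClosure (Rel ps) x) eq (label-sound ps x)))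
      (EqC.transitive _ (EqC.map there (EqC.symmetric _ (label-sound ps s)))
        (EqC.transitive _ (EqC.return (here refl))
          (EqC.map there (label-sound ps t))))

  label-complete : ∀ ps {x y} → Rel ps x y → label ps x ≡ label ps y
  label-complete ((s , t) ∷ ps) (here refl)
    with label ps s ≟ˢ label ps s | label ps t ≟ˢ label ps s
  ... | yes _  | yes _ = refl
  ... | yes _  | no  _ = refl
  ... | no  ¬p | _     = contradiction refl ¬p
  label-complete ((s , t) ∷ ps) (there xy) =
    cong (λ z → if does (z ≟ˢ label ps s) then label ps t else z)
         (label-complete ps xy)

label-correct : ∀ w {x y} →
  label (gluings w) x ≡ label (gluings w) y ⇔ SameVertex w x y
label-correct w {x} {y} = mk⇔
  (λ eq → EqC.transitive _
     (subst (EqClosure (Glued w) x) eq (label-sound (gluings w) x))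
     (EqC.symmetric _ (label-sound (gluings w) y)))
  (EqC.gfold isEquivalence (label (gluings w)) (label-complete (gluings w)))

#vertices : Word → ℕ
#vertices w = length (deduplicate _≟ˢ_ (map (label (gluings w)) w))

#edges : Word → ℕ
#edges w = length w / 2

-- The cell structure has one face, so 2 - 2g = #vertices - #edges + 1.
-- For a word representing a closed orientable surface neither the truncated
-- subtraction nor the division loses anything.
genus : Word → ℕ
genus w = (suc (#edges w) ∸ #vertices w) / 2

private
  variable
    n : ℕ

-- Fin n is {1,…,n} shifted down by one, so k : Fin n gives the letter
-- suc (toℕ k).
letter : Sign → Fin n → Side
letter s k = suc (toℕ k) , s

increasing decreasing : Sign → Subset n → Word
increasing {n} s K = map (letter s) (filter (_∈? K) (allFin n))
decreasing s K = reverse (increasing s K)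

R₁ R₂ R₃ R₄ : Subset n → Word
R₁ K = decreasing + K
R₂ K = increasing + (∁ K)
R₃ T = decreasing - T
R₄ T = increasing - (∁ T)

word₁ word₆ : Subset n → Subset n → Word
word₁ K T = R₁ K ++ R₂ K ++ R₃ T ++ R₄ T
word₆ K T = [ 0 , + ] ++ R₁ K ++ R₄ T ++ [ 0 , - ] ++ R₂ K ++ R₃ T

subsets : ∀ n → List (Subset n)
subsets 0       = [ Vec.[] ]
subsets (suc n) =
  map (outside Vec.∷_) (subsets n) ++ map (inside Vec.∷_) (subsets n)

-- Lists, because surfaces are counted with multiplicity.
S₁ S₆ : ℕ → List Word
S₁ n = cartesianProductWith word₁ (subsets n) (subsets n)
S₆ n = cartesianProductWith word₆ (subsets n) (subsets n)

#genus : List Word → ℕ → ℕ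
#genus S i = length (filter (λ w → genus w ℕ.≟ i) S)

IsMinimumGenus IsMaximumGenus : List Word → ℕ → Set
IsMinimumGenus S γ = γ ∈ map genus S × All (γ ≤_) (map genus S)
IsMaximumGenus S γ = γ ∈ map genus S × All (_≤ γ) (map genus S)

-- In the next two definitions the finite sequence is f q, f (q + 1), …, f r;
-- values of f outside this range play no role.
LogConcave : (f : ℕ → ℕ) (q r : ℕ) → Set
LogConcave f q r =
  ∀ i → q ≤ i → suc (suc i) ≤ r → f i * f (suc (suc i)) ≤ f (suc i) * f (suc i)

record Unimodal (f : ℕ → ℕ) (q l m r : ℕ) : Set where
  field
    q≤l     : q ≤ l
    l≤m     : l ≤ m
    m≤r     : m ≤ r
    rising  : ∀ i → q ≤ i → suc i < l → f i ≤ f (suc i)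
    ascent  : ∀ i → q ≤ i → suc i ≡ l → f i < f (suc i)
    plateau : ∀ i → l ≤ i → i < m → f i ≡ f (suc i)
    descent : m < r → f (suc m) < f m
    falling : ∀ i → m < i → i < r → f (suc i) ≤ f i

GenusDistributionLogConcave : List Word → Set
GenusDistributionLogConcave S = ∃₂ λ γ γᴹ →
  IsMinimumGenus S γ × IsMaximumGenus S γᴹ × LogConcave (#genus S) γ γᴹ

GenusDistributionPeak : List Word → ℕ → Set
GenusDistributionPeak S p = ∃₂ λ γ γᴹ →
  IsMinimumGenus S γ × IsMaximumGenus S γᴹ × Unimodal (#genus S) γ p p γᴹ

{-# OPTIONS --safe #-}
module Submission where

-- Strip the letters a₁, a₂, … off from the inside of the words.  In R₁R₂R₃R₄ the letter a₁ separates
-- R₁ from R₂ and a₁⁻ separates R₃ from R₄, whatever K and T are, so it is a word of the form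
-- R₁ s R₂ R₃ s⁻ R₄ in the remaining letters.  There the next letter is either parallel to s and can
-- be dropped, or crosses s and splits off a handle, leaving R₁R₂R₃R₄; each happens for two of the four
-- choices.  The words of S₆ satisfy the same recursion.  Hence the genus polynomials are
-- 2ⁿFₙ for S₆ⁿ and 4·2ⁿFₙ for S₁ⁿ⁺¹, where Fₙ₊₂ = Fₙ₊₁ + 2xFₙ.  The ratios of consecutive coefficients of
-- Fₙ and Fₙ₊₁ interlace, which the recursion preserves; this gives log-concavity and makes the
-- ratio at a fixed index increase with n, so that the peak is located by comparing two
-- coefficients of Fₙ, known as sums of binomial coefficients, for n divisible by 3 and for n ≡ 1 mod 3.

open import Defs
import Algebra.Solver.CommutativeMonoid as CommutativeMonoidSolver
import Algebra.Solver.Monoid as MonoidSolver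
open import Data.Bool using (true; false; if_then_else_)
open import Data.Fin using (Fin; suc; toℕ)
open import Data.Fin.Subset using (Subset; inside; outside; ∁)
open import Data.Fin.Subset.Properties using (_∈?_)
open import Data.List using (List; []; _∷_; [_]; _++_; map; length; filter; deduplicate; zip; reverse; allFin; tabulate; cartesianProductWith)
open import Data.List.Membership.Propositional using (_∈_)
open import Data.List.Membership.Propositional.Properties using (∈-filter⁺; ∈-map⁺; ∈-map⁻; ∈-deduplicate⁺; ∈-deduplicate⁻)
open import Data.List.Properties using (length-++; length-map; map-cong; map-id; map-++; map-∘; map-tabulate; ++-assoc; ++-identityʳ; ++-monoid; unfold-reverse; filter-all; filter-notAll; filter-++; filter-some; filter-reject; cartesianProductWith-distribʳ-++)
open import Data.List.Relation.Binary.Permutation.Propositional using (_↭_; ↭-refl; ↭-reflexive; ↭-sym; ↭-trans; prep)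
open import Data.List.Relation.Binary.Permutation.Propositional.Properties using (All-resp-↭; ∈-resp-↭; map⁺; ++-comm; shift; ↭-length; ↭-reverse; ++-commutativeMonoid)
open import Data.List.Relation.Binary.Subset.Propositional using (_⊆_)
open import Data.List.Relation.Unary.All as All using (All; []; _∷_)
open import Data.List.Relation.Unary.All.Properties using (++⁺; ++⁻)
open import Data.List.Relation.Unary.AllPairs using ([]; _∷_)
open import Data.List.Relation.Unary.Any as Any using (here; there)
open import Data.List.Relation.Unary.Unique.DecPropositional.Properties _≟ˢ_ using (deduplicate-!)
open import Data.List.Relation.Unary.Unique.Propositional using (Unique)
open import Data.Nat using (ℕ; suc; _+_; _*_; _∸_; _^_; _/_; _%_; _≤_; _<_; _≡ᵇ_; ⌈_/2⌉; NonZero; >-nonZero; z≤n; s≤s; s≤s⁻¹)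
open import Data.Nat.Combinatorics using (nCk≡nC[n∸k]; k>n⇒nCk≡0; nCn≡1; nCk+nC[k+1]≡[n+1]C[k+1]) renaming (_C_ to _choose_)
open import Data.Nat.DivMod using (m*n/n≡m; m≡m%n+[m/n]*n; m%n<n)
open import Data.Nat.ListAction using (sum)
open import Data.Nat.Properties
open import Data.Nat.Tactic.RingSolver using (solve-∀)
open import Data.Product using (_×_; _,_; proj₁; proj₂)
open import Data.Sign as Sign using (Sign)
open import Data.Sum using (inj₁; inj₂)
import Data.Vec as Vec
open import Function using (_∘_; _∘₂_)
open import Relation.Binary.PropositionalEquality hiding ([_])
open import Relation.Nullary using (yes; no; does; ¬?; contradiction)

-- `genus` is computed from an explicit labelling, which does not evaluate on words with variable K
-- and T. The labelling is therefore used through its universal property: functions that respect the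
-- gluings factor through it. A vertex count then depends only on the gluing pairs up to order, and
-- the boundary of the polygon can be cut into stretches that are permuted and rejoined at corners
-- occurring in no other pair. Each surgery on words is such a regrouping, followed by Euler's
-- relation. Since the ratio of the coefficients i + 1 and i of Fₙ grows with n, a rise at i
-- persists for larger n and a fall at i for smaller n. The index r + 1 is the peak for n = 3r + 1,
-- 3r + 2 and 3r + 3, so the rise before it is needed at the first of these only and the fall after
-- it at the last. The excluded cases come from F₁ = 1 + x, whose two coefficients are equal: it
-- governs S₁ for n = 2 and S₆ for n = 1.

private
  variable
    n k g : ℕ
    s t x y z p q : Side
    u v w : Word
    ps qs : List (Side × Side)

module List-++ = MonoidSolver (++-monoid Side)

-- Counting the classes of the equivalence relation generated by a list of pairs

length-⊆ : Unique u → u ⊆ v → length u ≤ length v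
length-⊆ [] u⊆v = z≤n
length-⊆ {x ∷ u} {v} (x∉u ∷ u!) u⊆v = ≤-trans
  (s≤s (length-⊆ u! λ y∈u → ∈-filter⁺ x≢? (u⊆v (there y∈u)) (All.lookup x∉u y∈u)))
  (filter-notAll x≢? v (Any.map (λ x≡y x≢y → x≢y x≡y) (u⊆v (here refl))))
  where x≢? = ¬? ∘ (x ≟ˢ_)

distinct : List Side → ℕ
distinct = length ∘ deduplicate _≟ˢ_

distinct-≤ : ∀ (h : Side → Side) {xs ys} → xs ⊆ map h ys → distinct xs ≤ distinct ys
distinct-≤ h {xs} {ys} xs⊆ = subst (distinct xs ≤_) (length-map h (deduplicate _≟ˢ_ ys))
  (length-⊆ (deduplicate-! xs) sub)
  where
  sub : deduplicate _≟ˢ_ xs ⊆ map h (deduplicate _≟ˢ_ ys)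
  sub x∈ with ∈-map⁻ h (xs⊆ (∈-deduplicate⁻ _≟ˢ_ xs x∈))
  ... | y , y∈ , refl = ∈-map⁺ h (∈-deduplicate⁺ _≟ˢ_ y∈)

Respects : (Side → Side) → List (Side × Side) → Set
Respects f = All λ (s , t) → f s ≡ f t

label-respects : ∀ ps → Respects (label ps) ps
label-respects []             = []
label-respects ((s , t) ∷ ps) =
  head ∷ All.map (cong λ x → if does (x ≟ˢ label ps s) then label ps t else x)
                 (label-respects ps)
  where
  head : label ((s , t) ∷ ps) s ≡ label ((s , t) ∷ ps) t
  head with label ps s ≟ˢ label ps s | label ps t ≟ˢ label ps s
  ... | yes _ | yes _ = refl
  ... | yes _ | no  _ = refl
  ... | no ¬p | _     = contradiction refl ¬p

-- Merging only replaces the label of `s` by that of `t`, and `f` has the same value on both.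
-- Together with `label-respects` this makes `label ps` universal among the functions respecting
-- `ps`.
label-universal : ∀ f ps → Respects f ps → ∀ x → f (label ps x) ≡ f x
label-universal f []             []       x = refl
label-universal f ((s , t) ∷ ps) (e ∷ es) x with label ps x ≟ˢ label ps s
... | no  _  = label-universal f ps es x
... | yes eq = begin
  f (label ps t) ≡⟨ label-universal f ps es t ⟩
  f t            ≡⟨ e ⟨
  f s            ≡⟨ label-universal f ps es s ⟨
  f (label ps s) ≡⟨ cong f eq ⟨
  f (label ps x) ≡⟨ label-universal f ps es x ⟩
  f x            ∎
  where open ≡-Reasoning

-- Targets suffice: in the gluings along a closed boundary every corner is the target of exactly one
-- pair.
sides : List (Side × Side) → List Side
sides = map proj₂

-- Opaque, since unifying terms #classes ps would otherwise run the labelling.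
opaque
  #classes : List (Side × Side) → ℕ
  #classes ps = distinct (map (label ps) (sides ps))

  #classes-def : ∀ ps → #classes ps ≡ distinct (map (label ps) (sides ps))
  #classes-def ps = refl

-- By `label-universal`, `h` factors through `label ps`, so every label given by `qs` is the image
-- of one given by `ps`. Two such maps in opposite directions show that two counts agree.
#classes-≤ : ∀ h → Respects h ps → sides qs ⊆ sides ps → (∀ {x} → x ∈ sides qs → label qs x ≡ h x) →
             #classes qs ≤ #classes ps
#classes-≤ {ps} {qs} h resp sub agree =
  subst₂ _≤_ (sym (#classes-def qs)) (sym (#classes-def ps)) (distinct-≤ h λ l∈ → helper l∈)
  where
  helper : ∀ {l} → l ∈ map (label qs) (sides qs) → l ∈ map h (map (label ps) (sides ps))
  helper l∈ with ∈-map⁻ (label qs) l∈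
  ... | x , x∈ , refl = subst (_∈ map h (map (label ps) (sides ps)))
    (trans (label-universal h ps resp x) (sym (agree x∈)))
    (∈-map⁺ h (∈-map⁺ (label ps) (sub x∈)))

#classes-↭ : ps ↭ qs → #classes ps ≡ #classes qs
#classes-↭ ps↭qs = ≤-antisym (le (↭-sym ps↭qs)) (le ps↭qs)
  where
  le : ps ↭ qs → #classes qs ≤ #classes ps
  le {ps} {qs} ps↭qs = #classes-≤ (label qs)
    (All-resp-↭ (↭-sym ps↭qs) (label-respects qs))
    (∈-resp-↭ (map⁺ proj₂ (↭-sym ps↭qs))) (λ _ → refl)

Fresh : Side → List (Side × Side) → Set
Fresh z = All λ (s , t) → s ≢ z × t ≢ z

fresh-side : Fresh z ps → x ∈ sides ps → x ≢ z
fresh-side fr x∈ with ∈-map⁻ proj₂ x∈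
... | _ , p∈ , refl = proj₂ (All.lookup fr p∈)

replace : Side → Side → Side → Side
replace z q x = if does (x ≟ˢ z) then q else x

replace-≡ : ∀ z q → replace z q z ≡ q
replace-≡ z q with z ≟ˢ z
... | yes _ = refl
... | no ¬p = contradiction refl ¬p

replace-≢ : ∀ q → x ≢ z → replace z q x ≡ x
replace-≢ {x} {z} q x≢z with x ≟ˢ z
... | yes p = contradiction p x≢z
... | no  _ = refl

replace-target : ∀ z q → replace z q q ≡ q
replace-target z q with q ≟ˢ z
... | yes _ = refl
... | no  _ = refl

-- The corner `z` only passes the identification on from `p` to `q`. It lies in the class of `q`, so
-- dropping it loses no class; renaming it to `q` turns a labelling of the short list into one
-- respecting the long list.
#classes-contract : Fresh z ps → p ≢ z →
  #classes ((p , z) ∷ (z , q) ∷ ps) ≡ #classes ((p , q) ∷ ps)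
#classes-contract {z} {ps} {p} {q} fr p≢z = ≤-antisym
  (subst₂ _≤_ (sym (#classes-def long)) (sym (#classes-def short)) (distinct-≤ f le))
  (#classes-≤ h (h-pz ∷ h-zq ∷ h-ps) there agree)
  where
  long = (p , z) ∷ (z , q) ∷ ps
  short = (p , q) ∷ ps
  f = label long
  f′ = label short
  f-resp = label-respects long
  f′-resp = label-respects short
  f-short : Respects f short
  f-short = trans (All.lookup f-resp (here refl)) (All.lookup f-resp (there (here refl)))
          ∷ All.tail (All.tail f-resp)
  le : map f (sides long) ⊆ map f (map f′ (sides short))
  le (here refl) = here (trans (All.lookup f-resp (there (here refl)))
                               (sym (label-universal f short f-short q)))
  le (there x∈) with ∈-map⁻ f x∈
  ... | x , x∈′ , refl = subst (_∈ map f (map f′ (sides short)))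
    (label-universal f short f-short x) (∈-map⁺ f (∈-map⁺ f′ x∈′))
  h = f′ ∘ replace z q
  h-pz : h p ≡ h z
  h-pz = trans (cong f′ (replace-≢ q p≢z))
    (trans (All.head f′-resp) (sym (cong f′ (replace-≡ z q))))
  h-zq : h z ≡ h q
  h-zq = cong f′ (trans (replace-≡ z q) (sym (replace-target z q)))
  h-ps : Respects h ps
  h-ps = All.zipWith
    (λ ((s≢z , t≢z) , e) → trans (cong f′ (replace-≢ q s≢z)) (trans e (sym (cong f′ (replace-≢ q t≢z)))))
    (fr , All.tail f′-resp)
  agree : x ∈ sides short → f′ x ≡ h x
  agree (here refl) = sym (cong f′ (replace-target z q))
  agree (there x∈)  = sym (cong f′ (replace-≢ q (fresh-side fr x∈)))

-- The pair glues nothing, but it lists the corner `z`, which by freshness is a class of its own.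
#classes-isolated : Fresh z ps → #classes ((z , z) ∷ ps) ≡ suc (#classes ps)
#classes-isolated {z} {ps} fr = begin
  #classes ((z , z) ∷ ps)
    ≡⟨ #classes-def _ ⟩
  distinct (map (label ((z , z) ∷ ps)) (z ∷ sides ps))
    ≡⟨ cong distinct (map-cong same (z ∷ sides ps)) ⟩
  distinct (map (label ps) (z ∷ sides ps))
    ≡⟨ cong (suc ∘ length) (filter-all (¬? ∘ (label ps z ≟ˢ_)) (All.tabulate new)) ⟩
  suc (distinct (map (label ps) (sides ps)))
    ≡⟨ cong suc (#classes-def ps) ⟨
  suc (#classes ps) ∎
  where
  open ≡-Reasoning
  same : ∀ x → label ((z , z) ∷ ps) x ≡ label ps x
  same x with label ps x ≟ˢ label ps z
  ... | yes eq = sym eq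
  ... | no  _  = refl
  -- Separates z from every other side and respects ps, so no other side is labelled like z.
  d = λ x → if does (x ≟ˢ z) then (0 , Sign.+) else (0 , Sign.-)
  d-≢ : x ≢ z → d x ≡ (0 , Sign.-)
  d-≢ {x} x≢z with x ≟ˢ z
  ... | yes p = contradiction p x≢z
  ... | no  _ = refl
  d-z : d z ≡ (0 , Sign.+)
  d-z with z ≟ˢ z
  ... | yes _ = refl
  ... | no ¬p = contradiction refl ¬p
  d-resp : Respects d ps
  d-resp = All.map (λ (s≢z , t≢z) → trans (d-≢ s≢z) (sym (d-≢ t≢z))) fr
  new : ∀ {l} → l ∈ deduplicate _≟ˢ_ (map (label ps) (sides ps)) → label ps z ≢ l
  new l∈ eq with ∈-map⁻ (label ps) (∈-deduplicate⁻ _≟ˢ_ (map (label ps) (sides ps)) l∈)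
  ... | x , x∈ , refl = contradiction
    (begin (0 , Sign.+) ≡⟨ d-z ⟨ d z ≡⟨ label-universal d ps d-resp z ⟨ d (label ps z) ≡⟨ cong d eq ⟩
           d (label ps x) ≡⟨ label-universal d ps d-resp x ⟩ d x ≡⟨ d-≢ (fresh-side fr x∈) ⟩ (0 , Sign.-) ∎)
    λ ()

-- Walks along the boundary and Euler's relation

-- The gluings along a stretch `w` of the boundary: `p` is the inverse of the side before it, `q`
-- the corner after it.
walk : Side → Word → Side → List (Side × Side)
walk p []      q = [ p , q ]
walk p (c ∷ w) q = (p , c) ∷ walk (inverse c) w q

walk-++ : ∀ p u c v q → walk p (u ++ c ∷ v) q ≡ walk p u c ++ walk (inverse c) v q
walk-++ p []      c v q = refl
walk-++ p (d ∷ u) c v q = cong ((p , d) ∷_) (walk-++ (inverse d) u c v q)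

inverse-involutive : ∀ s → inverse (inverse s) ≡ s
inverse-involutive (_ , Sign.+) = refl
inverse-involutive (_ , Sign.-) = refl

inverse-≢ : ∀ s → inverse s ≢ s
inverse-≢ (_ , Sign.+) ()
inverse-≢ (_ , Sign.-) ()

-- Letters are compared, not sides, because a walk along `w` contains the inverses of the sides of
-- `w` as well.
_≢ˡ_ : Side → Side → Set
s ≢ˡ t = proj₁ s ≢ proj₁ t

≢ˡ⇒≢ : s ≢ˡ t → s ≢ t
≢ˡ⇒≢ s≢t = s≢t ∘ cong proj₁

Avoids : Side → Word → Set
Avoids z = All (_≢ˡ z)

fresh-walk : p ≢ z → Avoids z w → q ≢ z → Fresh z (walk p w q)
fresh-walk p≢ []        q≢ = (p≢ , q≢) ∷ []
fresh-walk p≢ (c≢ ∷ w≢) q≢ = (p≢ , ≢ˡ⇒≢ c≢) ∷ fresh-walk (≢ˡ⇒≢ c≢) w≢ q≢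

-- The first walk ends at the corner `z` and the second starts there; contracting `z` makes `C` and
-- `D` consecutive. The induction moves the pairs before the end of `C` into `ps`, until the two
-- pairs that contain `z` stand in front.
contract : ∀ C D → p ≢ z → q ≢ z → Avoids z C → Avoids z D → Fresh z ps →
  #classes (walk p C z ++ walk z D q ++ ps) ≡ #classes (walk p (C ++ D) q ++ ps)
contract [] []      p≢ q≢ _ _ fr = #classes-contract fr p≢
contract [] (d ∷ D) p≢ q≢ _ (d≢ ∷ D≢) fr =
  #classes-contract (++⁺ (fresh-walk (≢ˡ⇒≢ d≢) D≢ q≢) fr) p≢
contract {p} {z} {q} {ps} (c ∷ C) D p≢ q≢ (c≢ ∷ C≢) D≢ fr = begin
  #classes ((p , c) ∷ walk c⁻ C z ++ walk z D q ++ ps)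
    ≡⟨ #classes-↭ (move (walk c⁻ C z) (walk z D q)) ⟩
  #classes (walk c⁻ C z ++ walk z D q ++ (p , c) ∷ ps)
    ≡⟨ contract C D (≢ˡ⇒≢ c≢) q≢ C≢ D≢ ((p≢ , ≢ˡ⇒≢ c≢) ∷ fr) ⟩
  #classes (walk c⁻ (C ++ D) q ++ (p , c) ∷ ps)
    ≡⟨ #classes-↭ (shift (p , c) (walk c⁻ (C ++ D) q) ps) ⟩
  #classes ((p , c) ∷ walk c⁻ (C ++ D) q ++ ps) ∎
  where
  open ≡-Reasoning
  c⁻ = inverse c
  move : ∀ us vs → (p , c) ∷ us ++ vs ++ ps ↭ us ++ vs ++ (p , c) ∷ ps
  move us vs = ↭-sym (subst₂ _↭_ (++-assoc us vs _) (cong ((p , c) ∷_) (++-assoc us vs ps))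
    (shift (p , c) (us ++ vs) ps))

cycle : Side → Word → List (Side × Side)
cycle z w = walk z w z

-- The vertices are counted with a spare corner z marked on the boundary of the polygon, so that
-- the empty word also gets its vertex and is a sphere.
record HasGenus (w : Word) (g : ℕ) : Set where
  field
    edges   : ℕ
    length≡ : length w ≡ edges * 2
    euler   : ∀ z → Avoids z w → #classes (cycle z w) + g * 2 ≡ suc edges

open HasGenus

private
  gluings-walk : ∀ s w → gluings (s ∷ w) ≡ walk (inverse s) w s
  gluings-walk s w = zip-walk s w s
    where
    zip-walk : ∀ s w t → zip (map inverse (s ∷ w)) (w ++ [ t ]) ≡ walk (inverse s) w t
    zip-walk s []      t = refl
    zip-walk s (c ∷ w) t = cong ((inverse s , c) ∷_) (zip-walk c w t)

  sides-walk : ∀ p w q → sides (walk p w q) ≡ w ++ [ q ]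
  sides-walk p []      q = refl
  sides-walk p (c ∷ w) q = cong (c ∷_) (sides-walk (inverse c) w q)

-- In a nonempty word the spare corner lies between the last side and `s`; contracting it gives back
-- the gluings of the cyclic word.
#vertices-cycle : ∀ z s w → Avoids z (s ∷ w) → #vertices (s ∷ w) ≡ #classes (cycle z (s ∷ w))
#vertices-cycle z s w (s≢ ∷ w≢) = begin
  #vertices (s ∷ w)
    ≡⟨ cong (λ ps → distinct (map (label ps) (s ∷ w))) (gluings-walk s w) ⟩
  distinct (map (label W) (s ∷ w))
    ≡⟨ ≤-antisym (rearrange (++-comm [ s ] w)) (rearrange (++-comm w [ s ])) ⟩
  distinct (map (label W) (w ++ [ s ]))
    ≡⟨ cong (distinct ∘ map (label W)) (sides-walk (inverse s) w s) ⟨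
  distinct (map (label W) (sides W))
    ≡⟨ #classes-def W ⟨
  #classes W
    ≡⟨ cong (λ v → #classes (walk (inverse s) v s)) (++-identityʳ w) ⟨
  #classes (walk (inverse s) (w ++ []) s)
    ≡⟨ cong #classes (++-identityʳ (walk (inverse s) (w ++ []) s)) ⟨
  #classes (walk (inverse s) (w ++ []) s ++ [])
    ≡⟨ contract w [] (≢ˡ⇒≢ s≢) (≢ˡ⇒≢ s≢) w≢ [] [] ⟨
  #classes (walk (inverse s) w z ++ [ z , s ])
    ≡⟨ #classes-↭ (++-comm (walk (inverse s) w z) [ z , s ]) ⟩
  #classes (cycle z (s ∷ w)) ∎
  where
  open ≡-Reasoning
  W = walk (inverse s) w s
  rearrange : u ↭ v → distinct (map (label W) u) ≤ distinct (map (label W) v)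
  rearrange u↭v = distinct-≤ (λ x → x) (∈-resp-↭ (↭-trans (map⁺ (label W) u↭v) (↭-reflexive (sym (map-id _)))))

unused : Word → Side
unused w = suc (sum (map proj₁ w)) , Sign.+

unused-avoids : ∀ w → Avoids (unused w) w
unused-avoids w = All.map <⇒≢ (bound w)
  where
  bound : ∀ w → All (λ c → proj₁ c < proj₁ (unused w)) w
  bound []      = []
  bound (c ∷ w) = s≤s (m≤m+n (proj₁ c) _) ∷
    All.map (λ lt → <-≤-trans lt (s≤s (m≤n+m _ (proj₁ c)))) (bound w)

hasGenus⇒genus : ∀ w {g} → HasGenus w g → genus w ≡ g
-- For the empty word `#vertices` is 0 and the genus is 1 / 2, rounded down to 0. In `euler` the
-- spare corner is the single vertex, which forces `g` to be 0 too.
hasGenus⇒genus [] {g} h with edges h | length≡ h | euler h (0 , Sign.+) []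
... | 0 | refl | e = sym (m*n≡0⇒m≡0 g 2 (suc-injective
  (trans (cong (_+ g * 2) (sym (#classes-def [ _ ]))) e)))
hasGenus⇒genus w@(s ∷ w′) {g} h = begin
  (suc (length w / 2) ∸ #vertices w) / 2
    ≡⟨ cong₂ (λ a b → (suc (a / 2) ∸ b) / 2) (length≡ h) (#vertices-cycle o s w′ o∉) ⟩
  (suc (edges h * 2 / 2) ∸ V) / 2
    ≡⟨ cong (λ a → (suc a ∸ V) / 2) (m*n/n≡m (edges h) 2) ⟩
  (suc (edges h) ∸ V) / 2
    ≡⟨ cong (λ a → (a ∸ V) / 2) (euler h o o∉) ⟨
  (V + g * 2 ∸ V) / 2
    ≡⟨ cong (_/ 2) (m+n∸m≡n V (g * 2)) ⟩
  g * 2 / 2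
    ≡⟨ m*n/n≡m g 2 ⟩
  g ∎
  where
  open ≡-Reasoning
  o = unused w
  o∉ = unused-avoids w
  V = #classes (cycle o w)

-- The genus under moves on words

empty-hasGenus : HasGenus [] 0
empty-hasGenus = record
  { edges   = 0
  ; length≡ = refl
  ; euler   = λ z _ → trans (+-identityʳ _) (#classes-def [ z , z ])
  }

-- A second spare corner, `inverse z`, is put between `v` and `u`. Contracting it leaves the cycle
-- through `v ++ u` marked at `z`; contracting `z` instead leaves the rotated cycle.
rotate : ∀ u v → HasGenus (u ++ v) g → HasGenus (v ++ u) g
rotate {g} u v h = record
  { edges   = edges h
  ; length≡ = trans (↭-length (++-comm v u)) (length≡ h)
  ; euler   = λ z z∉ → let (v≢ , u≢) = ++⁻ v z∉ ; z≢z⁻ = inverse-≢ z ∘ sym in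
      trans (cong (_+ g * 2) (vertices z z≢z⁻ u≢ v≢)) (euler h (inverse z) (++⁺ u≢ v≢))
  }
  where
  open ≡-Reasoning
  vertices : ∀ z → z ≢ inverse z → Avoids z u → Avoids z v →
    #classes (cycle z (v ++ u)) ≡ #classes (cycle (inverse z) (u ++ v))
  vertices z z≢ u≢ v≢ = begin
    #classes (cycle z (v ++ u))
      ≡⟨ cong #classes (++-identityʳ (cycle z (v ++ u))) ⟨
    #classes (cycle z (v ++ u) ++ [])
      ≡⟨ contract v u z≢ z≢ v≢ u≢ [] ⟨
    #classes (walk z v z⁻ ++ walk z⁻ u z ++ [])
      ≡⟨ cong (λ ps → #classes (walk z v z⁻ ++ ps)) (++-identityʳ (walk z⁻ u z)) ⟩
    #classes (walk z v z⁻ ++ walk z⁻ u z)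
      ≡⟨ #classes-↭ (++-comm (walk z v z⁻) (walk z⁻ u z)) ⟩
    #classes (walk z⁻ u z ++ walk z v z⁻)
      ≡⟨ cong (λ ps → #classes (walk z⁻ u z ++ ps)) (++-identityʳ (walk z v z⁻)) ⟨
    #classes (walk z⁻ u z ++ walk z v z⁻ ++ [])
      ≡⟨ contract u v (z≢ ∘ sym) (z≢ ∘ sym) u≢ v≢ [] ⟩
    #classes (cycle z⁻ (u ++ v) ++ [])
      ≡⟨ cong #classes (++-identityʳ (cycle z⁻ (u ++ v))) ⟩
    #classes (cycle z⁻ (u ++ v)) ∎
    where z⁻ = inverse z

-- The corner between `x` and its inverse is glued only to itself. The pair thus adds one vertex and
-- one edge, and the corner `x` can be contracted.
cancel : ∀ x w → Avoids x w → HasGenus w g → HasGenus (x ∷ inverse x ∷ w) g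
cancel {g} x w x∉ h = record
  { edges   = suc (edges h)
  ; length≡ = cong (λ l → suc (suc l)) (length≡ h)
  ; euler   = λ { z (x≢ ∷ x⁻≢ ∷ w≢) →
      trans (cong (_+ g * 2) (vertices z x≢ w≢)) (cong suc (euler h z w≢)) }
  }
  where
  open ≡-Reasoning
  x⁻ = inverse x
  vertices : ∀ z → x ≢ˡ z → Avoids z w →
    #classes (cycle z (x ∷ x⁻ ∷ w)) ≡ suc (#classes (cycle z w))
  vertices z x≢z w≢ = begin
    #classes ((z , x) ∷ (x⁻ , x⁻) ∷ walk (inverse x⁻) w z)
      ≡⟨ cong (λ y → #classes ((z , x) ∷ (x⁻ , x⁻) ∷ walk y w z)) (inverse-involutive x) ⟩
    #classes ((z , x) ∷ (x⁻ , x⁻) ∷ walk x w z)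
      ≡⟨ #classes-↭ (shift (x⁻ , x⁻) [ z , x ] (walk x w z)) ⟩
    #classes ((x⁻ , x⁻) ∷ (z , x) ∷ walk x w z)
      ≡⟨ #classes-isolated ((z≢x⁻ , x≢x⁻) ∷ fresh-walk x≢x⁻ x∉ z≢x⁻) ⟩
    suc (#classes ((z , x) ∷ walk x w z))
      ≡⟨ cong (λ ps → suc (#classes ((z , x) ∷ ps))) (++-identityʳ (walk x w z)) ⟨
    suc (#classes (walk z [] x ++ walk x w z ++ []))
      ≡⟨ cong suc (contract [] w z≢x z≢x [] x∉ []) ⟩
    suc (#classes (cycle z w ++ []))
      ≡⟨ cong (suc ∘ #classes) (++-identityʳ (cycle z w)) ⟩
    suc (#classes (cycle z w)) ∎
    where
    z≢x = ≢ˡ⇒≢ (x≢z ∘ sym)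
    z≢x⁻ = ≢ˡ⇒≢ (x≢z ∘ sym)
    x≢x⁻ = inverse-≢ x ∘ sym

-- The end of `x`, which is the start of `y`, is a vertex of degree two, formed by the corners `y`
-- and `x⁻`: the path `x y` is a subdivided edge. Removing `x` costs one vertex and one edge.
merge-parallel : ∀ x y U V → x ≢ˡ y → Avoids x U → Avoids y U → Avoids x V → Avoids y V →
  HasGenus (y ∷ U ++ inverse y ∷ V) g →
  HasGenus (x ∷ y ∷ U ++ inverse y ∷ inverse x ∷ V) g
merge-parallel {g} x y U V x≢y x∉U y∉U x∉V y∉V h = record
  { edges   = suc (edges h)
  ; length≡ = trans (cong suc (lengths U V)) (cong (λ l → suc (suc l)) (length≡ h))
  ; euler   = λ { z (x≢ ∷ y≢ ∷ r≢) → let (U≢ , r) = ++⁻ U r≢ ; V≢ = All.tail (All.tail r) in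
      trans (cong (_+ g * 2) (vertices z x≢ y≢ U≢ V≢)) (cong suc (euler h z (y≢ ∷ ++⁺ U≢ (y≢ ∷ V≢)))) }
  }
  where
  open ≡-Reasoning
  x⁻ = inverse x
  y⁻ = inverse y
  y≢x = x≢y ∘ sym
  lengths : ∀ U V → length (y ∷ U ++ y⁻ ∷ x⁻ ∷ V) ≡ suc (length (y ∷ U ++ y⁻ ∷ V))
  lengths U V = cong suc (begin
    length (U ++ y⁻ ∷ x⁻ ∷ V)       ≡⟨ length-++ U ⟩
    length U + suc (suc (length V)) ≡⟨ +-suc (length U) (suc (length V)) ⟩
    suc (length U + suc (length V)) ≡⟨ cong suc (length-++ U) ⟨
    suc (length (U ++ y⁻ ∷ V))      ∎)
  reduce : ∀ s z → s ≢ˡ z → Avoids s V → Fresh s ps →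
    #classes (walk z [] s ++ walk s V z ++ ps) ≡ #classes (walk z V z ++ ps)
  reduce s z s≢z s∉V fr = contract [] V (≢ˡ⇒≢ (s≢z ∘ sym)) (≢ˡ⇒≢ (s≢z ∘ sym)) [] s∉V fr
  vertices : ∀ z → x ≢ˡ z → y ≢ˡ z → Avoids z U → Avoids z V →
    #classes (cycle z (x ∷ y ∷ U ++ y⁻ ∷ x⁻ ∷ V)) ≡ suc (#classes (cycle z (y ∷ U ++ y⁻ ∷ V)))
  vertices z x≢z y≢z U≢ V≢ = begin
    #classes ((z , x) ∷ (x⁻ , y) ∷ walk y⁻ (U ++ y⁻ ∷ x⁻ ∷ V) z)
      ≡⟨ cong (λ ps → #classes ((z , x) ∷ (x⁻ , y) ∷ ps)) (walk-++ y⁻ U y⁻ (x⁻ ∷ V) z) ⟩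
    #classes ((z , x) ∷ (x⁻ , y) ∷ walk y⁻ U y⁻ ++ (inverse y⁻ , x⁻) ∷ walk (inverse x⁻) V z)
      ≡⟨ cong₂ (λ s t → #classes ((z , x) ∷ (x⁻ , y) ∷ walk y⁻ U y⁻ ++ (s , x⁻) ∷ walk t V z))
           (inverse-involutive y) (inverse-involutive x) ⟩
    #classes ((z , x) ∷ (x⁻ , y) ∷ walk y⁻ U y⁻ ++ (y , x⁻) ∷ walk x V z)
      ≡⟨ #classes-↭ (solve 5 (λ a b c d e → (a ⊕ b ⊕ c ⊕ d ⊕ e) ⊜ (b ⊕ d ⊕ a ⊕ e ⊕ c)) ↭-refl
           [ z , x ] [ x⁻ , y ] (walk y⁻ U y⁻) [ y , x⁻ ] (walk x V z)) ⟩
    #classes ((x⁻ , y) ∷ (y , x⁻) ∷ (z , x) ∷ walk x V z ++ walk y⁻ U y⁻)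
      ≡⟨ contract [] [] x⁻≢y x⁻≢y [] [] ((z≢y , ≢ˡ⇒≢ x≢y)
           ∷ ++⁺ (fresh-walk (≢ˡ⇒≢ x≢y) y∉V z≢y) (fresh-walk y⁻≢y y∉U y⁻≢y)) ⟩
    #classes ((x⁻ , x⁻) ∷ (z , x) ∷ walk x V z ++ walk y⁻ U y⁻)
      ≡⟨ #classes-isolated ((z≢x⁻ , x≢x⁻)
           ∷ ++⁺ (fresh-walk x≢x⁻ x∉V z≢x⁻) (fresh-walk (≢ˡ⇒≢ y≢x) x∉U (≢ˡ⇒≢ y≢x))) ⟩
    suc (#classes ((z , x) ∷ walk x V z ++ walk y⁻ U y⁻))
      -- The two words now differ only in the corner, `x` or `y`, at which `V` is joined to `z`;
      -- contracting either one gives the same list.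
      ≡⟨ cong suc (reduce x z x≢z x∉V (fresh-walk (≢ˡ⇒≢ y≢x) x∉U (≢ˡ⇒≢ y≢x))) ⟩
    suc (#classes (walk z V z ++ walk y⁻ U y⁻))
      ≡⟨ cong suc (reduce y z y≢z y∉V (fresh-walk y⁻≢y y∉U y⁻≢y)) ⟨
    suc (#classes ((z , y) ∷ walk y V z ++ walk y⁻ U y⁻))
      ≡⟨ cong suc (#classes-↭ (prep _ (++-comm (walk y V z) (walk y⁻ U y⁻)))) ⟩
    suc (#classes ((z , y) ∷ walk y⁻ U y⁻ ++ walk y V z))
      ≡⟨ cong (λ s → suc (#classes ((z , y) ∷ walk y⁻ U y⁻ ++ walk s V z))) (inverse-involutive y) ⟨
    suc (#classes ((z , y) ∷ walk y⁻ U y⁻ ++ walk (inverse y⁻) V z))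
      ≡⟨ cong (λ ps → suc (#classes ((z , y) ∷ ps))) (walk-++ y⁻ U y⁻ V z) ⟨
    suc (#classes (cycle z (y ∷ U ++ y⁻ ∷ V))) ∎
    where
    open CommutativeMonoidSolver (++-commutativeMonoid {A = Side × Side})
    x≢x⁻ = inverse-≢ x ∘ sym
    y⁻≢y = inverse-≢ y
    x⁻≢y = ≢ˡ⇒≢ x≢y
    z≢x⁻ = ≢ˡ⇒≢ (x≢z ∘ sym)
    z≢y = ≢ˡ⇒≢ (y≢z ∘ sym)

-- The stretches of boundary between the four sides join into one closed walk: from `y⁻` along `C`
-- to `x⁻`, along `B` to `y`, along `E` through `z` to `x`, and along `D` back to `y⁻`. The vertex
-- count is unchanged while two edges are added, so the genus grows by one.
handle : ∀ x y B C D E → x ≢ˡ y → Avoids x (((C ++ B) ++ E) ++ D) → Avoids y (((C ++ B) ++ E) ++ D) →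
  HasGenus (((C ++ B) ++ E) ++ D) g →
  HasGenus (x ∷ B ++ y ∷ C ++ inverse x ∷ D ++ inverse y ∷ E) (suc g)
handle {g} x y B C D E x≢y x∉ y∉ h = record
  { edges   = suc (suc (edges h))
  ; length≡ = trans lengths (cong (4 +_) (length≡ h))
  ; euler   = λ { z (x≢ ∷ r) →
      let (B≢ , r₁) = ++⁻ B r ; (C≢ , r₂) = ++⁻ C (All.tail r₁) ; (D≢ , r₃) = ++⁻ D (All.tail r₂) in
      begin
        #classes (cycle z word) + suc g * 2  ≡⟨ cong (_+ suc g * 2) (vertices z x≢ (All.head r₁) B≢ C≢ D≢ (All.tail r₃)) ⟩
        V + (2 + g * 2)                      ≡⟨ +-suc V _ ⟩
        suc (V + suc (g * 2))                ≡⟨ cong suc (+-suc V _) ⟩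
        -- The letter of `y⁻` is absent from the reduced word, so this corner can be its spare
        -- corner.
        2 + (V + g * 2)                      ≡⟨ cong (2 +_) (euler h y⁻ y∉) ⟩
        3 + edges h                          ∎ }
  }
  where
  open ≡-Reasoning
  x⁻ = inverse x
  y⁻ = inverse y
  word = x ∷ B ++ y ∷ C ++ x⁻ ∷ D ++ y⁻ ∷ E
  rest = ((C ++ B) ++ E) ++ D
  V = #classes (cycle y⁻ rest)
  lengths : length word ≡ 4 + length rest
  lengths = ↭-length (solve 8 (λ a b c d e f g h →
      (a ⊕ b ⊕ c ⊕ d ⊕ e ⊕ f ⊕ g ⊕ h) ⊜ (a ⊕ c ⊕ e ⊕ g ⊕ ((d ⊕ b) ⊕ h) ⊕ f)) ↭-refl
      [ x ] B [ y ] C [ x⁻ ] D [ y⁻ ] E)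
    where open CommutativeMonoidSolver (++-commutativeMonoid {A = Side})
  vertices : ∀ z → x ≢ˡ z → y ≢ˡ z → Avoids z B → Avoids z C → Avoids z D → Avoids z E →
    #classes (cycle z word) ≡ V
  vertices z x≢z y≢z B≢ C≢ D≢ E≢ = begin
    #classes ((z , x) ∷ walk x⁻ (B ++ y ∷ C ++ x⁻ ∷ D ++ y⁻ ∷ E) z)
      ≡⟨ cong (λ ps → #classes ((z , x) ∷ ps)) split ⟩
    #classes ((z , x) ∷ walk x⁻ B y ++ walk y⁻ C x⁻ ++ walk x D y⁻ ++ walk y E z)
      ≡⟨ #classes-↭ (solve 5 (λ a b c d e → (a ⊕ b ⊕ c ⊕ d ⊕ e) ⊜ (c ⊕ b ⊕ e ⊕ a ⊕ d)) ↭-refl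
           [ z , x ] (walk x⁻ B y) (walk y⁻ C x⁻) (walk x D y⁻) (walk y E z)) ⟩
    #classes (walk y⁻ C x⁻ ++ walk x⁻ B y ++ walk y E z ++ (z , x) ∷ walk x D y⁻)
      ≡⟨ contract C B (≢ˡ⇒≢ y≢x) (≢ˡ⇒≢ y≢x) x∉C x∉B
           (++⁺ (fresh-walk (≢ˡ⇒≢ y≢x) x∉E (≢ˡ⇒≢ z≢x))
             ((≢ˡ⇒≢ z≢x , x≢x⁻) ∷ fresh-walk x≢x⁻ x∉D (≢ˡ⇒≢ y≢x))) ⟩
    #classes (walk y⁻ (C ++ B) y ++ walk y E z ++ (z , x) ∷ walk x D y⁻)
      ≡⟨ contract (C ++ B) E y⁻≢y (≢ˡ⇒≢ z≢y) y∉CB y∉E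
           ((≢ˡ⇒≢ z≢y , ≢ˡ⇒≢ x≢y) ∷ fresh-walk (≢ˡ⇒≢ x≢y) y∉D y⁻≢y) ⟩
    #classes (walk y⁻ ((C ++ B) ++ E) z ++ walk z [] x ++ walk x D y⁻)
      ≡⟨ contract ((C ++ B) ++ E) [] (≢ˡ⇒≢ y≢z) (≢ˡ⇒≢ x≢z) (++⁺ (++⁺ C≢ B≢) E≢) []
           (fresh-walk (≢ˡ⇒≢ x≢z) D≢ (≢ˡ⇒≢ y≢z)) ⟩
    #classes (walk y⁻ (((C ++ B) ++ E) ++ []) x ++ walk x D y⁻)
      ≡⟨ cong₂ (λ w ps → #classes (walk y⁻ w x ++ ps)) (++-identityʳ ((C ++ B) ++ E))
           (sym (++-identityʳ (walk x D y⁻))) ⟩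
    #classes (walk y⁻ ((C ++ B) ++ E) x ++ walk x D y⁻ ++ [])
      ≡⟨ contract ((C ++ B) ++ E) D (≢ˡ⇒≢ y≢x) (≢ˡ⇒≢ y≢x) x∉CBE x∉D [] ⟩
    #classes (cycle y⁻ rest ++ [])
      ≡⟨ cong #classes (++-identityʳ (cycle y⁻ rest)) ⟩
    V ∎
    where
    open CommutativeMonoidSolver (++-commutativeMonoid {A = Side × Side})
    split : walk x⁻ (B ++ y ∷ C ++ x⁻ ∷ D ++ y⁻ ∷ E) z ≡
            walk x⁻ B y ++ walk y⁻ C x⁻ ++ walk x D y⁻ ++ walk y E z
    split = begin
      walk x⁻ (B ++ y ∷ C ++ x⁻ ∷ D ++ y⁻ ∷ E) z
        ≡⟨ walk-++ x⁻ B y (C ++ x⁻ ∷ D ++ y⁻ ∷ E) z ⟩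
      walk x⁻ B y ++ walk y⁻ (C ++ x⁻ ∷ D ++ y⁻ ∷ E) z
        ≡⟨ cong (walk x⁻ B y ++_) (walk-++ y⁻ C x⁻ (D ++ y⁻ ∷ E) z) ⟩
      walk x⁻ B y ++ walk y⁻ C x⁻ ++ walk (inverse x⁻) (D ++ y⁻ ∷ E) z
        ≡⟨ cong (λ ps → walk x⁻ B y ++ walk y⁻ C x⁻ ++ ps) (walk-++ (inverse x⁻) D y⁻ E z) ⟩
      walk x⁻ B y ++ walk y⁻ C x⁻ ++ walk (inverse x⁻) D y⁻ ++ walk (inverse y⁻) E z
        ≡⟨ cong₂ (λ s t → walk x⁻ B y ++ walk y⁻ C x⁻ ++ walk s D y⁻ ++ walk t E z)
             (inverse-involutive x) (inverse-involutive y) ⟩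
      walk x⁻ B y ++ walk y⁻ C x⁻ ++ walk x D y⁻ ++ walk y E z ∎
    y≢x = x≢y ∘ sym
    z≢x = x≢z ∘ sym
    z≢y = y≢z ∘ sym
    x≢x⁻ = inverse-≢ x ∘ sym
    y⁻≢y = inverse-≢ y
    x∉CBE = proj₁ (++⁻ ((C ++ B) ++ E) x∉)
    x∉D = proj₂ (++⁻ ((C ++ B) ++ E) x∉)
    x∉E = proj₂ (++⁻ (C ++ B) x∉CBE)
    x∉C = proj₁ (++⁻ C (proj₁ (++⁻ (C ++ B) x∉CBE)))
    x∉B = proj₂ (++⁻ C (proj₁ (++⁻ (C ++ B) x∉CBE)))
    y∉CB = proj₁ (++⁻ (C ++ B) (proj₁ (++⁻ ((C ++ B) ++ E) y∉)))
    y∉E = proj₂ (++⁻ (C ++ B) (proj₁ (++⁻ ((C ++ B) ++ E) y∉)))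
    y∉D = proj₂ (++⁻ ((C ++ B) ++ E) y∉)

-- The four factors, with letters numbered from an offset

-- The offset lets the tail of a subset keep its letters, so that a recursion on subsets removes the
-- smallest letter without renaming the others.
lettersFrom : ℕ → Sign → Subset n → Word
lettersFrom k s Vec.[]              = []
lettersFrom k s (inside Vec.∷ K) = (suc k , s) ∷ lettersFrom (suc k) s K
lettersFrom k s (outside Vec.∷ K) = lettersFrom (suc k) s K

increasing≡lettersFrom : ∀ s (K : Subset n) → increasing s K ≡ lettersFrom 0 s K
increasing≡lettersFrom s = go 0
  where
  open ≡-Reasoning
  name : ∀ {m} → ℕ → Fin m → Side
  name k i = suc (k + toℕ i) , s
  shift-name : ∀ {m} k b (K : Subset m) xs →
    map (name k) (filter (_∈? (b Vec.∷ K)) (map suc xs)) ≡ map (name (suc k)) (filter (_∈? K) xs)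
  shift-name k b K []       = refl
  shift-name k b K (i ∷ xs) with i ∈? K
  ... | yes _ = cong₂ (λ a w → (suc a , s) ∷ w) (+-suc k (toℕ i)) (shift-name k b K xs)
  ... | no  _ = shift-name k b K xs
  go : ∀ {m} k (K : Subset m) → map (name k) (filter (_∈? K) (allFin m)) ≡ lettersFrom k s K
  rest : ∀ {m} k b (K : Subset m) →
    map (name k) (filter (_∈? (b Vec.∷ K)) (tabulate suc)) ≡ lettersFrom (suc k) s K
  rest {m} k b K = begin
    map (name k) (filter (_∈? (b Vec.∷ K)) (tabulate suc))
      ≡⟨ cong (λ xs → map (name k) (filter (_∈? (b Vec.∷ K)) xs)) (map-tabulate (λ i → i) suc) ⟨
    map (name k) (filter (_∈? (b Vec.∷ K)) (map suc (allFin m)))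
      ≡⟨ shift-name k b K (allFin m) ⟩
    map (name (suc k)) (filter (_∈? K) (allFin m))
      ≡⟨ go (suc k) K ⟩
    lettersFrom (suc k) s K ∎
  go k Vec.[]              = refl
  go k (inside Vec.∷ K) = cong₂ (λ a w → (suc a , s) ∷ w) (+-identityʳ k) (rest k inside K)
  go k (outside Vec.∷ K) = rest k outside K

Above : ℕ → Word → Set
Above k = All λ c → k < proj₁ c

above-avoids : ∀ s → proj₁ s ≤ k → Above k w → Avoids s w
above-avoids s s≤k = All.map λ k<c → <⇒≢ (≤-<-trans s≤k k<c) ∘ sym

lettersFrom-above : ∀ k s (K : Subset n) → Above k (lettersFrom k s K)
lettersFrom-above k s Vec.[]              = []
lettersFrom-above k s (inside Vec.∷ K) =
  ≤-refl ∷ All.map <⇒≤ (lettersFrom-above (suc k) s K)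
lettersFrom-above k s (outside Vec.∷ K) = All.map <⇒≤ (lettersFrom-above (suc k) s K)

r₁ r₂ r₃ r₄ : ℕ → Subset n → Word
r₁ k K = reverse (lettersFrom k Sign.+ K)
r₂ k K = lettersFrom k Sign.+ (∁ K)
r₃ k T = reverse (lettersFrom k Sign.- T)
r₄ k T = lettersFrom k Sign.- (∁ T)

module _ (k : ℕ) (K : Subset n) where
  r₁-above : Above k (r₁ k K)
  r₁-above = All-resp-↭ (↭-sym (↭-reverse _)) (lettersFrom-above k Sign.+ K)
  r₂-above : Above k (r₂ k K)
  r₂-above = lettersFrom-above k Sign.+ (∁ K)
  r₃-above : Above k (r₃ k K)
  r₃-above = All-resp-↭ (↭-sym (↭-reverse _)) (lettersFrom-above k Sign.- K)
  r₄-above : Above k (r₄ k K)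
  r₄-above = lettersFrom-above k Sign.- (∁ K)

hasGenus-resp : u ≡ v → HasGenus u g → HasGenus v g
hasGenus-resp refl h = h

-- Genus recursions for the two families

open List-++ using (_⊕_; _⊜_; solve)

-- Up to a rotation this is `handle` with nothing between `x` and `y` and nothing between their
-- inverses.
crossing : ∀ x y A U D → x ≢ˡ y → Avoids x (A ++ U ++ D) → Avoids y (A ++ U ++ D) →
  HasGenus (A ++ U ++ D) g →
  HasGenus (A ++ x ∷ y ∷ U ++ inverse x ∷ inverse y ∷ D) (suc g)
crossing {g} x y A U D x≢y x∉ y∉ h =
  rotate (x ∷ y ∷ U ++ inverse x ∷ inverse y ∷ D) A (hasGenus-resp eq
    (handle x y [] U [] (D ++ A) x≢y (av x x∉) (av y y∉) (hasGenus-resp eq′ (rotate A (U ++ D) h))))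
  where
  eq : x ∷ y ∷ U ++ inverse x ∷ inverse y ∷ D ++ A ≡ (x ∷ y ∷ U ++ inverse x ∷ inverse y ∷ D) ++ A
  eq = cong (λ w → x ∷ y ∷ w) (sym (++-assoc U _ A))
  eq′ : (U ++ D) ++ A ≡ ((U ++ []) ++ D ++ A) ++ []
  eq′ = solve 3 (λ a u d → ((u ⊕ d) ⊕ a) ⊜ (((u ⊕ List-++.id) ⊕ (d ⊕ a)) ⊕ List-++.id)) refl A U D
  av : ∀ z → Avoids z (A ++ U ++ D) → Avoids z (((U ++ []) ++ D ++ A) ++ [])
  av z z∉ = subst (Avoids z) eq′ (++⁺ (proj₂ (++⁻ A z∉)) (proj₁ (++⁻ A z∉)))

parallel : ∀ x y A U D → x ≢ˡ y → Avoids x (A ++ U ++ D) → Avoids y (A ++ U ++ D) →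
  HasGenus (A ++ y ∷ U ++ inverse y ∷ D) g →
  HasGenus (A ++ x ∷ y ∷ U ++ inverse y ∷ inverse x ∷ D) g
parallel {g} x y A U D x≢y x∉ y∉ h =
  rotate (x ∷ y ∷ U ++ inverse y ∷ inverse x ∷ D) A (hasGenus-resp eq
    (merge-parallel x y U (D ++ A) x≢y (avU x x∉) (avU y y∉) (avV x x∉) (avV y y∉)
      (hasGenus-resp eq′ (rotate A (y ∷ U ++ inverse y ∷ D) h))))
  where
  eq : x ∷ y ∷ U ++ inverse y ∷ inverse x ∷ D ++ A ≡ (x ∷ y ∷ U ++ inverse y ∷ inverse x ∷ D) ++ A
  eq = cong (λ w → x ∷ y ∷ w) (sym (++-assoc U _ A))
  eq′ : (y ∷ U ++ inverse y ∷ D) ++ A ≡ y ∷ U ++ inverse y ∷ D ++ A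
  eq′ = cong (y ∷_) (++-assoc U _ A)
  avU : ∀ z → Avoids z (A ++ U ++ D) → Avoids z U
  avU z z∉ = proj₁ (++⁻ U (proj₂ (++⁻ A z∉)))
  avV : ∀ z → Avoids z (A ++ U ++ D) → Avoids z (D ++ A)
  avV z z∉ = ++⁺ (proj₂ (++⁻ U (proj₂ (++⁻ A z∉)))) (proj₁ (++⁻ A z∉))

-- The genera of word₁ K T and word₆ K T (genus-ladder), computed from the letter a₁ upwards.
genus-closed genus-ladder : Subset n → Subset n → ℕ
genus-closed Vec.[]        Vec.[]        = 0
genus-closed (b Vec.∷ K) (c Vec.∷ T) = genus-ladder K T
genus-ladder Vec.[]              Vec.[]              = 0
genus-ladder (inside Vec.∷ K)  (inside Vec.∷ T) = suc (genus-closed K T)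
genus-ladder (inside Vec.∷ K)  (outside Vec.∷ T) = genus-ladder K T
genus-ladder (outside Vec.∷ K) (inside Vec.∷ T) = genus-ladder K T
genus-ladder (outside Vec.∷ K) (outside Vec.∷ T) = suc (genus-closed K T)

closed : ℕ → Subset n → Subset n → Word
closed k K T = r₁ k K ++ r₂ k K ++ r₃ k T ++ r₄ k T

ladder : ℕ → Side → Subset n → Subset n → Word
ladder k s K T = r₁ k K ++ s ∷ r₂ k K ++ r₃ k T ++ inverse s ∷ r₄ k T

r₁-inside : ∀ k (K : Subset n) → r₁ k (inside Vec.∷ K) ≡ r₁ (suc k) K ++ [ suc k , Sign.+ ]
r₁-inside k K = unfold-reverse (suc k , Sign.+) (lettersFrom (suc k) Sign.+ K)

r₃-inside : ∀ k (T : Subset n) → r₃ k (inside Vec.∷ T) ≡ r₃ (suc k) T ++ [ suc k , Sign.- ]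
r₃-inside k T = unfold-reverse (suc k , Sign.-) (lettersFrom (suc k) Sign.- T)

-- The smallest letter would end the decreasing factor or begin the increasing one; either way it
-- stands at their junction.
r₁₂-cons : ∀ k b (K : Subset n) → r₁ k (b Vec.∷ K) ++ r₂ k (b Vec.∷ K) ≡
  r₁ (suc k) K ++ (suc k , Sign.+) ∷ r₂ (suc k) K
r₁₂-cons k inside  K = trans (cong (_++ r₂ (suc k) K) (r₁-inside k K)) (++-assoc (r₁ (suc k) K) _ _)
r₁₂-cons k outside K = refl

r₃₄-cons : ∀ k c (T : Subset n) → r₃ k (c Vec.∷ T) ++ r₄ k (c Vec.∷ T) ≡
  r₃ (suc k) T ++ (suc k , Sign.-) ∷ r₄ (suc k) T
r₃₄-cons k inside  T = trans (cong (_++ r₄ (suc k) T) (r₃-inside k T)) (++-assoc (r₃ (suc k) T) _ _)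
r₃₄-cons k outside T = refl

closed-cons : ∀ k b c (K T : Subset n) →
  closed k (b Vec.∷ K) (c Vec.∷ T) ≡ ladder (suc k) (suc k , Sign.+) K T
closed-cons k b c K T = begin
  r₁ k (b Vec.∷ K) ++ r₂ k (b Vec.∷ K) ++ r₃ k (c Vec.∷ T) ++ r₄ k (c Vec.∷ T)
    ≡⟨ ++-assoc (r₁ k (b Vec.∷ K)) _ _ ⟨
  (r₁ k (b Vec.∷ K) ++ r₂ k (b Vec.∷ K)) ++ r₃ k (c Vec.∷ T) ++ r₄ k (c Vec.∷ T)
    ≡⟨ cong₂ _++_ (r₁₂-cons k b K) (r₃₄-cons k c T) ⟩
  (r₁ (suc k) K ++ (suc k , Sign.+) ∷ r₂ (suc k) K) ++ r₃ (suc k) T ++ (suc k , Sign.-) ∷ r₄ (suc k) T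
    ≡⟨ ++-assoc (r₁ (suc k) K) _ _ ⟩
  ladder (suc k) (suc k , Sign.+) K T ∎
  where open ≡-Reasoning

spherical-pair : ∀ s → HasGenus (s ∷ inverse s ∷ []) 0
spherical-pair s = cancel s [] [] empty-hasGenus

closed-avoids : ∀ k s (K T : Subset n) → proj₁ s ≤ k → Avoids s (closed k K T)
closed-avoids k s K T s≤k = ++⁺ (av (r₁-above k K)) (++⁺ (av (r₂-above k K))
  (++⁺ (av (r₃-above k T)) (av (r₄-above k T))))
  where av : Above k w → Avoids s w
        av = above-avoids s s≤k

closed-hasGenus : ∀ k (K T : Subset n) → HasGenus (closed k K T) (genus-closed K T)
-- The new letter stands next to `s` and its inverse next to `s⁻`. Equal choices `b`, `c` put both
-- before or both after, which gives a crossing; different choices nest one pair inside the other.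
-- The inner pair of the two is kept, which may be the new letter, so `s` has to be arbitrary.
ladder-hasGenus : ∀ k s (K T : Subset n) → proj₁ s ≤ k → HasGenus (ladder k s K T) (genus-ladder K T)

closed-hasGenus k Vec.[]        Vec.[]        = empty-hasGenus
closed-hasGenus k (b Vec.∷ K) (c Vec.∷ T) =
  hasGenus-resp (sym (closed-cons k b c K T))
    (ladder-hasGenus (suc k) (suc k , Sign.+) K T ≤-refl)

ladder-hasGenus k s Vec.[] Vec.[] _ = spherical-pair s
ladder-hasGenus k s (b Vec.∷ K) (c Vec.∷ T) s≤k = step b c
  where
  a = (suc k , Sign.+)
  a⁻ = (suc k , Sign.-)
  s⁻ = inverse s
  A = r₁ (suc k) K
  B = r₂ (suc k) K
  C = r₃ (suc k) T
  D = r₄ (suc k) T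
  s≢a : s ≢ˡ a
  s≢a = <⇒≢ (s≤s s≤k)
  s≤sk = m≤n⇒m≤1+n s≤k
  assoc-UD : A ++ (B ++ C) ++ D ≡ closed (suc k) K T
  assoc-UD = cong (A ++_) (++-assoc B C D)
  s∉ : Avoids s (A ++ (B ++ C) ++ D)
  s∉ = subst (Avoids s) (sym assoc-UD) (closed-avoids (suc k) s K T s≤sk)
  a∉ : Avoids a (A ++ (B ++ C) ++ D)
  a∉ = subst (Avoids a) (sym assoc-UD) (closed-avoids (suc k) a K T ≤-refl)
  base : HasGenus (A ++ (B ++ C) ++ D) (genus-closed K T)
  base = hasGenus-resp (sym assoc-UD) (closed-hasGenus (suc k) K T)
  edge : ∀ x → proj₁ x ≤ suc k → HasGenus (A ++ x ∷ (B ++ C) ++ inverse x ∷ D) (genus-ladder K T)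
  edge x x≤ = hasGenus-resp (cong (λ w → A ++ x ∷ w) (sym (++-assoc B C _)))
    (ladder-hasGenus (suc k) x K T x≤)
  step : ∀ b c → HasGenus (ladder k s (b Vec.∷ K) (c Vec.∷ T)) (genus-ladder (b Vec.∷ K) (c Vec.∷ T))
  step inside inside = hasGenus-resp eq (crossing a s A (B ++ C) D (s≢a ∘ sym) a∉ s∉ base)
    where
    eq : A ++ a ∷ s ∷ (B ++ C) ++ a⁻ ∷ s⁻ ∷ D ≡ ladder k s (inside Vec.∷ K) (inside Vec.∷ T)
    eq = trans
      (solve 8 (λ A a s B C a⁻ s⁻ D → (A ⊕ a ⊕ s ⊕ (B ⊕ C) ⊕ a⁻ ⊕ s⁻ ⊕ D) ⊜ ((A ⊕ a) ⊕ s ⊕ B ⊕ (C ⊕ a⁻) ⊕ s⁻ ⊕ D))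
        refl A [ a ] [ s ] B C [ a⁻ ] [ s⁻ ] D)
      (cong₂ (λ P Q → P ++ s ∷ B ++ Q ++ s⁻ ∷ D) (sym (r₁-inside k K)) (sym (r₃-inside k T)))
  step inside outside = hasGenus-resp eq (parallel a s A (B ++ C) D (s≢a ∘ sym) a∉ s∉ (edge s s≤sk))
    where
    eq : A ++ a ∷ s ∷ (B ++ C) ++ s⁻ ∷ a⁻ ∷ D ≡ ladder k s (inside Vec.∷ K) (outside Vec.∷ T)
    eq = trans
      (solve 8 (λ A a s B C a⁻ s⁻ D → (A ⊕ a ⊕ s ⊕ (B ⊕ C) ⊕ s⁻ ⊕ a⁻ ⊕ D) ⊜ ((A ⊕ a) ⊕ s ⊕ B ⊕ C ⊕ s⁻ ⊕ a⁻ ⊕ D))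
        refl A [ a ] [ s ] B C [ a⁻ ] [ s⁻ ] D)
      (cong (λ P → P ++ s ∷ B ++ C ++ s⁻ ∷ a⁻ ∷ D) (sym (r₁-inside k K)))
  step outside inside = hasGenus-resp eq (parallel s a A (B ++ C) D s≢a s∉ a∉ (edge a ≤-refl))
    where
    eq : A ++ s ∷ a ∷ (B ++ C) ++ a⁻ ∷ s⁻ ∷ D ≡ ladder k s (outside Vec.∷ K) (inside Vec.∷ T)
    eq = trans
      (solve 8 (λ A a s B C a⁻ s⁻ D → (A ⊕ s ⊕ a ⊕ (B ⊕ C) ⊕ a⁻ ⊕ s⁻ ⊕ D) ⊜ (A ⊕ s ⊕ a ⊕ B ⊕ (C ⊕ a⁻) ⊕ s⁻ ⊕ D))
        refl A [ a ] [ s ] B C [ a⁻ ] [ s⁻ ] D)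
      (cong (λ Q → A ++ s ∷ a ∷ B ++ Q ++ s⁻ ∷ D) (sym (r₃-inside k T)))
  step outside outside = hasGenus-resp eq (crossing s a A (B ++ C) D s≢a s∉ a∉ base)
    where
    eq : A ++ s ∷ a ∷ (B ++ C) ++ s⁻ ∷ a⁻ ∷ D ≡ ladder k s (outside Vec.∷ K) (outside Vec.∷ T)
    eq = solve 8 (λ A a s B C a⁻ s⁻ D → (A ⊕ s ⊕ a ⊕ (B ⊕ C) ⊕ s⁻ ⊕ a⁻ ⊕ D) ⊜ (A ⊕ s ⊕ a ⊕ B ⊕ C ⊕ s⁻ ⊕ a⁻ ⊕ D))
      refl A [ a ] [ s ] B C [ a⁻ ] [ s⁻ ] D

a₀ : Side
a₀ = 0 , Sign.+

ladder₆ : ℕ → Subset n → Subset n → Word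
ladder₆ k K T = a₀ ∷ r₁ k K ++ r₄ k T ++ inverse a₀ ∷ r₂ k K ++ r₃ k T

-- For equal choices `a` interlaces with `a₀`, and the handle leaves `D ++ A ++ B ++ C`, a rotation
-- of the closed word. For different choices `a` meets its inverse or runs parallel to `a₀`. Here
-- `a₀` always survives, yet the recursion is that of `ladder`.
ladder₆-hasGenus : ∀ k (K T : Subset n) → HasGenus (ladder₆ k K T) (genus-ladder K T)
ladder₆-hasGenus k Vec.[] Vec.[] = spherical-pair a₀
ladder₆-hasGenus k (b Vec.∷ K) (c Vec.∷ T) = step b c
  where
  a = (suc k , Sign.+)
  a⁻ = (suc k , Sign.-)
  a₀⁻ = inverse a₀
  A = r₁ (suc k) K
  B = r₂ (suc k) K
  C = r₃ (suc k) T
  D = r₄ (suc k) T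
  av : ∀ s → proj₁ s ≤ suc k → Avoids s A × Avoids s B × Avoids s C × Avoids s D
  av s s≤ = above-avoids s s≤ (r₁-above _ K) , above-avoids s s≤ (r₂-above _ K) ,
            above-avoids s s≤ (r₃-above _ T) , above-avoids s s≤ (r₄-above _ T)
  rotated : HasGenus (D ++ A ++ B ++ C) (genus-closed K T)
  rotated = rotate (A ++ B ++ C) D (subst (λ w → HasGenus w _)
    (solve 4 (λ A B C D → (A ⊕ B ⊕ C ⊕ D) ⊜ ((A ⊕ B ⊕ C) ⊕ D)) refl A B C D)
    (closed-hasGenus (suc k) K T))
  avoid : ∀ s → proj₁ s ≤ suc k → Avoids s (D ++ A ++ B ++ C)
  avoid s s≤ = let (A∉ , B∉ , C∉ , D∉) = av s s≤ in ++⁺ D∉ (++⁺ A∉ (++⁺ B∉ C∉))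
  step : ∀ b c → HasGenus (ladder₆ k (b Vec.∷ K) (c Vec.∷ T)) (genus-ladder (b Vec.∷ K) (c Vec.∷ T))
  step inside inside = hasGenus-resp eq
    (handle a₀ a A D (B ++ C) [] (λ ())
      (subst (Avoids a₀) eq′ (avoid a₀ z≤n)) (subst (Avoids a) eq′ (avoid a ≤-refl))
      (hasGenus-resp eq′ rotated))
    where
    eq′ : D ++ A ++ B ++ C ≡ ((D ++ A) ++ []) ++ B ++ C
    eq′ = solve 4 (λ A B C D → (D ⊕ A ⊕ B ⊕ C) ⊜ (((D ⊕ A) ⊕ List-++.id) ⊕ B ⊕ C)) refl A B C D
    eq : a₀ ∷ A ++ a ∷ D ++ a₀⁻ ∷ (B ++ C) ++ a⁻ ∷ [] ≡ ladder₆ k (inside Vec.∷ K) (inside Vec.∷ T)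
    eq = trans
      (solve 8 (λ A a a₀ B C a⁻ a₀⁻ D → (a₀ ⊕ A ⊕ a ⊕ D ⊕ a₀⁻ ⊕ (B ⊕ C) ⊕ a⁻) ⊜ (a₀ ⊕ (A ⊕ a) ⊕ D ⊕ a₀⁻ ⊕ B ⊕ C ⊕ a⁻))
        refl A [ a ] [ a₀ ] B C [ a⁻ ] [ a₀⁻ ] D)
      (cong₂ (λ P Q → a₀ ∷ P ++ D ++ a₀⁻ ∷ B ++ Q) (sym (r₁-inside k K)) (sym (r₃-inside k T)))
  step inside outside = hasGenus-resp eq
    (rotate (a ∷ a⁻ ∷ D ++ a₀⁻ ∷ B ++ C) (a₀ ∷ A)
      (cancel a ((D ++ a₀⁻ ∷ B ++ C) ++ a₀ ∷ A) a∉
        (rotate (a₀ ∷ A) (D ++ a₀⁻ ∷ B ++ C) (ladder₆-hasGenus (suc k) K T))))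
    where
    a∉ : Avoids a ((D ++ a₀⁻ ∷ B ++ C) ++ a₀ ∷ A)
    a∉ = let (A∉ , B∉ , C∉ , D∉) = av a ≤-refl in
      ++⁺ (++⁺ D∉ ((λ ()) ∷ ++⁺ B∉ C∉)) ((λ ()) ∷ A∉)
    eq : a₀ ∷ A ++ a ∷ a⁻ ∷ D ++ a₀⁻ ∷ B ++ C ≡ ladder₆ k (inside Vec.∷ K) (outside Vec.∷ T)
    eq = trans
      (solve 8 (λ A a a₀ B C a⁻ a₀⁻ D → (a₀ ⊕ A ⊕ a ⊕ a⁻ ⊕ D ⊕ a₀⁻ ⊕ B ⊕ C) ⊜ (a₀ ⊕ (A ⊕ a) ⊕ a⁻ ⊕ D ⊕ a₀⁻ ⊕ B ⊕ C))
        refl A [ a ] [ a₀ ] B C [ a⁻ ] [ a₀⁻ ] D)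
      (cong (λ P → a₀ ∷ P ++ a⁻ ∷ D ++ a₀⁻ ∷ B ++ C) (sym (r₁-inside k K)))
  step outside inside = hasGenus-resp eq
    -- Moving the last side `a⁻` to the front nests the pair of `a₀` inside that of `a`.
    (rotate [ a⁻ ] (a₀ ∷ (A ++ D) ++ a₀⁻ ∷ a ∷ B ++ C)
      (merge-parallel a⁻ a₀ (A ++ D) (B ++ C) (λ ()) (AD a⁻ ≤-refl) (AD a₀ z≤n) (BC a⁻ ≤-refl) (BC a₀ z≤n)
        (hasGenus-resp (cong (a₀ ∷_) (sym (++-assoc A D _))) (ladder₆-hasGenus (suc k) K T))))
    where
    AD : ∀ s → proj₁ s ≤ suc k → Avoids s (A ++ D)
    AD s s≤ = let (A∉ , B∉ , C∉ , D∉) = av s s≤ in ++⁺ A∉ D∉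
    BC : ∀ s → proj₁ s ≤ suc k → Avoids s (B ++ C)
    BC s s≤ = let (A∉ , B∉ , C∉ , D∉) = av s s≤ in ++⁺ B∉ C∉
    eq : (a₀ ∷ (A ++ D) ++ a₀⁻ ∷ a ∷ B ++ C) ++ [ a⁻ ] ≡ ladder₆ k (outside Vec.∷ K) (inside Vec.∷ T)
    eq = trans
      (solve 8 (λ A a a₀ B C a⁻ a₀⁻ D → ((a₀ ⊕ (A ⊕ D) ⊕ a₀⁻ ⊕ a ⊕ B ⊕ C) ⊕ a⁻) ⊜ (a₀ ⊕ A ⊕ D ⊕ a₀⁻ ⊕ a ⊕ B ⊕ C ⊕ a⁻))
        refl A [ a ] [ a₀ ] B C [ a⁻ ] [ a₀⁻ ] D)
      (cong (λ Q → a₀ ∷ A ++ D ++ a₀⁻ ∷ a ∷ B ++ Q) (sym (r₃-inside k T)))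
  step outside outside = handle a₀ a⁻ A D [] (B ++ C) (λ ())
      (subst (Avoids a₀) eq′ (avoid a₀ z≤n)) (subst (Avoids a⁻) eq′ (avoid a⁻ ≤-refl))
      (hasGenus-resp eq′ rotated)
    where
    eq′ : D ++ A ++ B ++ C ≡ ((D ++ A) ++ B ++ C) ++ []
    eq′ = solve 4 (λ A B C D → (D ⊕ A ⊕ B ⊕ C) ⊜ (((D ⊕ A) ⊕ B ⊕ C) ⊕ List-++.id)) refl A B C D

word₁-genus : ∀ (K T : Subset n) → genus (word₁ K T) ≡ genus-closed K T
word₁-genus K T = trans (cong genus eq) (hasGenus⇒genus (closed 0 K T) (closed-hasGenus 0 K T))
  where
  eq : word₁ K T ≡ closed 0 K T
  eq rewrite increasing≡lettersFrom Sign.+ K | increasing≡lettersFrom Sign.+ (∁ K)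
           | increasing≡lettersFrom Sign.- T | increasing≡lettersFrom Sign.- (∁ T) = refl

word₆-genus : ∀ (K T : Subset n) → genus (word₆ K T) ≡ genus-ladder K T
word₆-genus K T = trans (cong genus eq) (hasGenus⇒genus (ladder₆ 0 K T) (ladder₆-hasGenus 0 K T))
  where
  eq : word₆ K T ≡ ladder₆ 0 K T
  eq rewrite increasing≡lettersFrom Sign.+ K | increasing≡lettersFrom Sign.+ (∁ K)
           | increasing≡lettersFrom Sign.- T | increasing≡lettersFrom Sign.- (∁ T) = refl

-- Genus polynomials

timesX : (ℕ → ℕ) → ℕ → ℕ
timesX f 0       = 0
timesX f (suc i) = f i

occurrences : ℕ → List ℕ → ℕ
occurrences i = length ∘ filter (_≟ i)

occurrences-++ : ∀ i xs ys → occurrences i (xs ++ ys) ≡ occurrences i xs + occurrences i ys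
occurrences-++ i xs ys = trans (cong length (filter-++ (_≟ i) xs ys)) (length-++ (filter (_≟ i) xs))

occurrences-map-suc : ∀ i xs → occurrences i (map suc xs) ≡ timesX (λ j → occurrences j xs) i
occurrences-map-suc 0       []       = refl
occurrences-map-suc 0       (x ∷ xs) = occurrences-map-suc 0 xs
occurrences-map-suc (suc i) []       = refl
occurrences-map-suc (suc i) (x ∷ xs) with x ≡ᵇ i
... | true  = cong suc (occurrences-map-suc (suc i) xs)
... | false = occurrences-map-suc (suc i) xs

#genus-occurrences : ∀ S i → #genus S i ≡ occurrences i (map genus S)
#genus-occurrences []      i = refl
#genus-occurrences (w ∷ S) i with genus w ≡ᵇ i
... | true  = cong suc (#genus-occurrences S i)
... | false = #genus-occurrences S i

map-cartesianProductWith : ∀ {A B C D : Set} (h : C → D) (f : A → B → C) xs ys →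
  map h (cartesianProductWith f xs ys) ≡ cartesianProductWith (h ∘₂ f) xs ys
map-cartesianProductWith h f []       ys = refl
map-cartesianProductWith h f (x ∷ xs) ys =
  trans (map-++ h (map (f x) ys) _) (cong₂ _++_ (sym (map-∘ ys)) (map-cartesianProductWith h f xs ys))

cartesianProductWith-cong : ∀ {A B C : Set} {f g : A → B → C} → (∀ x y → f x y ≡ g x y) → ∀ xs ys →
  cartesianProductWith f xs ys ≡ cartesianProductWith g xs ys
cartesianProductWith-cong eq []       ys = refl
cartesianProductWith-cong eq (x ∷ xs) ys =
  cong₂ _++_ (map-cong (eq x) ys) (cartesianProductWith-cong eq xs ys)

module _ {A : Set} (i : ℕ) where
  occurrences-splitʳ : (f : A → A → ℕ) → ∀ xs ys zs →
    occurrences i (cartesianProductWith f xs (ys ++ zs)) ≡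
    occurrences i (cartesianProductWith f xs ys) + occurrences i (cartesianProductWith f xs zs)
  occurrences-splitʳ f []       ys zs = refl
  occurrences-splitʳ f (x ∷ xs) ys zs = begin
    # (map (f x) (ys ++ zs) ++ P (ys ++ zs))
      ≡⟨ occurrences-++ i (map (f x) (ys ++ zs)) _ ⟩
    # (map (f x) (ys ++ zs)) + # (P (ys ++ zs))
      ≡⟨ cong₂ _+_ (trans (cong # (map-++ (f x) ys zs)) (occurrences-++ i (map (f x) ys) _))
           (occurrences-splitʳ f xs ys zs) ⟩
    (# (map (f x) ys) + # (map (f x) zs)) + (# (P ys) + # (P zs))
      ≡⟨ swap-middle (# (map (f x) ys)) (# (map (f x) zs)) (# (P ys)) (# (P zs)) ⟩
    (# (map (f x) ys) + # (P ys)) + (# (map (f x) zs) + # (P zs))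
      ≡⟨ cong₂ _+_ (occurrences-++ i (map (f x) ys) _) (occurrences-++ i (map (f x) zs) _) ⟨
    # (map (f x) ys ++ P ys) + # (map (f x) zs ++ P zs) ∎
    where
    open ≡-Reasoning
    # = occurrences i
    P = cartesianProductWith f xs
    swap-middle : ∀ a b c d → (a + b) + (c + d) ≡ (a + c) + (b + d)
    swap-middle = solve-∀

  occurrences-splitˡ : (f : A → A → ℕ) → ∀ xs ys zs →
    occurrences i (cartesianProductWith f (xs ++ ys) zs) ≡
    occurrences i (cartesianProductWith f xs zs) + occurrences i (cartesianProductWith f ys zs)
  occurrences-splitˡ f xs ys zs = trans (cong (occurrences i) (cartesianProductWith-distribʳ-++ f xs ys zs))
    (occurrences-++ i (cartesianProductWith f xs zs) _)

cartesianProductWith-map : ∀ {A B C D E : Set} (f : B → D → E) (g : A → B) (h : C → D) xs ys →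
  cartesianProductWith f (map g xs) (map h ys) ≡ cartesianProductWith (λ x y → f (g x) (h y)) xs ys
cartesianProductWith-map f g h []       ys = refl
cartesianProductWith-map f g h (x ∷ xs) ys =
  cong₂ _++_ (sym (map-∘ ys)) (cartesianProductWith-map f g h xs ys)

tally : (n : ℕ) → (Subset n → Subset n → ℕ) → ℕ → ℕ
tally n G i = occurrences i (cartesianProductWith G (subsets n) (subsets n))

tally-suc : ∀ n G i → tally (suc n) G i ≡
  (tally n (λ K T → G (outside Vec.∷ K) (outside Vec.∷ T)) i +
   tally n (λ K T → G (outside Vec.∷ K) (inside Vec.∷ T)) i) +
  (tally n (λ K T → G (inside Vec.∷ K) (outside Vec.∷ T)) i +
   tally n (λ K T → G (inside Vec.∷ K) (inside Vec.∷ T)) i)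
tally-suc n G i = trans (occurrences-splitˡ i G (map (outside Vec.∷_) (subsets n)) _ _)
  (cong₂ _+_ (half outside) (half inside))
  where
  half : ∀ b → occurrences i (cartesianProductWith G (map (b Vec.∷_) (subsets n)) (subsets (suc n))) ≡
    tally n (λ K T → G (b Vec.∷ K) (outside Vec.∷ T)) i + tally n (λ K T → G (b Vec.∷ K) (inside Vec.∷ T)) i
  half b = trans (occurrences-splitʳ i G (map (b Vec.∷_) (subsets n)) _ _)
    (cong₂ _+_ (cong (occurrences i) (cartesianProductWith-map G _ _ (subsets n) (subsets n)))
               (cong (occurrences i) (cartesianProductWith-map G _ _ (subsets n) (subsets n))))

tally-map-suc : ∀ n G i → tally n (λ K T → suc (G K T)) i ≡ timesX (tally n G) i
tally-map-suc n G i = trans (cong (occurrences i) (sym (map-cartesianProductWith suc G (subsets n) (subsets n))))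
  (occurrences-map-suc i (cartesianProductWith G (subsets n) (subsets n)))

timesX-cong : ∀ {f g} → (∀ i → f i ≡ g i) → ∀ i → timesX f i ≡ timesX g i
timesX-cong eq 0       = refl
timesX-cong eq (suc i) = eq i

tally-closed-suc : ∀ n i → tally (suc n) genus-closed i ≡ 4 * tally n genus-ladder i
tally-closed-suc n i = trans (tally-suc n genus-closed i) (four (tally n genus-ladder i))
  where
  four : ∀ a → (a + a) + (a + a) ≡ 4 * a
  four = solve-∀

tally-ladder-suc : ∀ n i → tally (suc n) genus-ladder i ≡
  2 * (tally n genus-ladder i + timesX (tally n genus-closed) i)
tally-ladder-suc n i = trans (tally-suc n genus-ladder i)
  (trans (cong₂ (λ a b → (a + l) + (l + b)) (tally-map-suc n genus-closed i) (tally-map-suc n genus-closed i))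
    (twice l (timesX (tally n genus-closed) i)))
  where
  l = tally n genus-ladder i
  twice : ∀ a b → (b + a) + (a + b) ≡ 2 * (a + b)
  twice = solve-∀

-- coeff n i is the coefficient of xⁱ in Fₙ, where F₀ = 1, F₁ = 1 + x and Fₙ₊₂ = Fₙ₊₁ + 2 x Fₙ.
coeff : ℕ → ℕ → ℕ
coeff 0             0       = 1
coeff 0             (suc i) = 0
coeff 1             i       = coeff 0 i + timesX (coeff 0) i
coeff (suc (suc n)) i       = coeff (suc n) i + 2 * timesX (coeff n) i

-- The closed tally enters with weight 2 · 4 two letters back; dividing by 2² leaves the 2 in the
-- recurrence for F. With no letters the closed tally is 1, without the factor 4, whence F₁ = 1 + x
-- as a separate initial value.
tally-ladder : ∀ n i → tally n genus-ladder i ≡ 2 ^ n * coeff n i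
tally-ladder 0 0 = refl
tally-ladder 0 (suc i) = refl
tally-ladder 1 i = begin
  tally 1 genus-ladder i
    ≡⟨ tally-ladder-suc 0 i ⟩
  2 * (tally 0 genus-ladder i + timesX (tally 0 genus-closed) i)
    ≡⟨ cong (2 *_) (cong₂ _+_ (zeroth i) (timesX-cong zeroth i)) ⟩
  2 * coeff 1 i ∎
  where
  open ≡-Reasoning
  zeroth : ∀ i → tally 0 genus-ladder i ≡ coeff 0 i
  zeroth 0       = refl
  zeroth (suc i) = refl
tally-ladder (suc (suc n)) i = begin
  tally (2 + n) genus-ladder i
    ≡⟨ tally-ladder-suc (suc n) i ⟩
  2 * (tally (1 + n) genus-ladder i + timesX (tally (1 + n) genus-closed) i)
    ≡⟨ cong (2 *_) (cong₂ _+_ (tally-ladder (suc n) i) (shifted i)) ⟩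
  2 * (2 ^ (1 + n) * coeff (1 + n) i + 4 * (2 ^ n * timesX (coeff n) i))
    ≡⟨ factor (2 ^ n) (coeff (1 + n) i) (timesX (coeff n) i) ⟩
  2 ^ (2 + n) * coeff (2 + n) i ∎
  where
  open ≡-Reasoning
  shifted : ∀ i → timesX (tally (1 + n) genus-closed) i ≡ 4 * (2 ^ n * timesX (coeff n) i)
  shifted 0       = sym (cong (4 *_) (*-zeroʳ (2 ^ n)))
  shifted (suc i) = trans (tally-closed-suc n i) (cong (4 *_) (tally-ladder n i))
  factor : ∀ p a b → 2 * (2 * p * a + 4 * (p * b)) ≡ 2 * (2 * p) * (a + 2 * b)
  factor = solve-∀

#genus-tally : ∀ {n} (f : Subset n → Subset n → Word) G → (∀ K T → genus (f K T) ≡ G K T) →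
  ∀ i → #genus (cartesianProductWith f (subsets n) (subsets n)) i ≡ tally n G i
#genus-tally {n} f G eq i = begin
  #genus (cartesianProductWith f (subsets n) (subsets n)) i
    ≡⟨ #genus-occurrences (cartesianProductWith f (subsets n) (subsets n)) i ⟩
  occurrences i (map genus (cartesianProductWith f (subsets n) (subsets n)))
    ≡⟨ cong (occurrences i) (map-cartesianProductWith genus f (subsets n) (subsets n)) ⟩
  tally n (genus ∘₂ f) i
    ≡⟨ cong (occurrences i) (cartesianProductWith-cong eq (subsets n) (subsets n)) ⟩
  tally n G i ∎
  where open ≡-Reasoning

#genus-S₆ : ∀ n i → #genus (S₆ n) i ≡ 2 ^ n * coeff n i
#genus-S₆ n i = trans (#genus-tally {n} word₆ genus-ladder word₆-genus i) (tally-ladder n i)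

#genus-S₁ : ∀ n i → #genus (S₁ (suc n)) i ≡ 4 * 2 ^ n * coeff n i
#genus-S₁ n i = begin
  #genus (S₁ (suc n)) i               ≡⟨ #genus-tally {suc n} word₁ genus-closed word₁-genus i ⟩
  tally (suc n) genus-closed i        ≡⟨ tally-closed-suc n i ⟩
  4 * tally n genus-ladder i          ≡⟨ cong (4 *_) (tally-ladder n i) ⟩
  4 * (2 ^ n * coeff n i)                 ≡⟨ *-assoc 4 (2 ^ n) (coeff n i) ⟨
  4 * 2 ^ n * coeff n i                   ∎
  where open ≡-Reasoning

-- Log-concavity through interlacing ratios

-- With αᵢ = aᵢ₊₁ / aᵢ and βᵢ = bᵢ₊₁ / bᵢ this is the chain β₀ ≥ α₀ ≥ β₁ ≥ α₁ ≥ ... in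
-- cross-multiplied form. It is stated for all pairs of indices, since inequalities between
-- neighbours do not compose across zero coefficients.
record Interlacing (a b : ℕ → ℕ) : Set where
  field
    lcˡ : ∀ {i j} → i ≤ j → a (suc j) * a i ≤ a j * a (suc i)
    lcʳ : ∀ {i j} → i ≤ j → b (suc j) * b i ≤ b j * b (suc i)
    a≼b : ∀ {i j} → i ≤ j → a (suc j) * b i ≤ a j * b (suc i)
    b≼a : ∀ {i j} → i < j → b (suc j) * a i ≤ b j * a (suc i)

open Interlacing

module _ {a b : ℕ → ℕ} (I : Interlacing a b) where
  private
    c : ℕ → ℕ
    c i = b i + 2 * timesX a i

  -- Every product expands into products of entries of `b` and shifted `a`, each bounded by one
  -- field of `I`; the shift by x exchanges the roles of `a≼b` and `b≼a`.
  interlacing-step : Interlacing b c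
  lcˡ interlacing-step = lcʳ I
  a≼b interlacing-step {0} {j} _ = begin
    b (suc j) * (b 0 + 0)     ≡⟨ cong (b (suc j) *_) (+-identityʳ (b 0)) ⟩
    b (suc j) * b 0           ≤⟨ lcʳ I z≤n ⟩
    b j * b 1                 ≤⟨ *-monoʳ-≤ (b j) (m≤m+n (b 1) _) ⟩
    b j * (b 1 + 2 * a 0)     ∎
    where open ≤-Reasoning
  a≼b interlacing-step {suc i} {j} i<j = begin
    b (suc j) * (b (suc i) + 2 * a i)                ≡⟨ expand (b (suc j)) (b (suc i)) (a i) ⟩
    b (suc j) * b (suc i) + 2 * (b (suc j) * a i)    ≤⟨ +-mono-≤ (lcʳ I i<j) (*-monoʳ-≤ 2 (b≼a I i<j)) ⟩
    b j * b (2 + i) + 2 * (b j * a (suc i))          ≡⟨ expand (b j) (b (2 + i)) (a (suc i)) ⟨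
    b j * (b (2 + i) + 2 * a (suc i))                ∎
    where
    open ≤-Reasoning
    expand : ∀ x y z → x * (y + 2 * z) ≡ x * y + 2 * (x * z)
    expand = solve-∀
  b≼a interlacing-step {i} {suc j} (s≤s i≤j) = begin
    (b (2 + j) + 2 * a (suc j)) * b i                    ≡⟨ expand (b i) (b (2 + j)) (a (suc j)) ⟩
    b (2 + j) * b i + 2 * (a (suc j) * b i)              ≤⟨ +-mono-≤ (lcʳ I (m≤n⇒m≤1+n i≤j)) (*-monoʳ-≤ 2 (a≼b I i≤j)) ⟩
    b (suc j) * b (suc i) + 2 * (a j * b (suc i))        ≡⟨ expand (b (suc i)) (b (suc j)) (a j) ⟨
    (b (suc j) + 2 * a j) * b (suc i)                    ∎
    where
    open ≤-Reasoning
    expand : ∀ x y z → (y + 2 * z) * x ≡ y * x + 2 * (z * x)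
    expand = solve-∀
  -- After the shift, `a≼b` bounds the cross term only off the diagonal; on the diagonal both sides
  -- are the same product.
  lcʳ interlacing-step {i} {j} i≤j with m≤n⇒m<n∨m≡n i≤j
  ... | inj₂ refl = ≤-reflexive (*-comm (c (suc i)) (c i))
  lcʳ interlacing-step {0} {suc j} _ | inj₁ _ = begin
    (b (2 + j) + 2 * a (suc j)) * (b 0 + 0)         ≡⟨ expand (b (2 + j)) (a (suc j)) (b 0) ⟩
    b (2 + j) * b 0 + 2 * (a (suc j) * b 0)         ≤⟨ +-mono-≤ (lcʳ I z≤n) (*-monoʳ-≤ 2 (a≼b I z≤n)) ⟩
    b (suc j) * b 1 + 2 * (a j * b 1)               ≡⟨ collect (b (suc j)) (a j) (b 1) ⟩
    (b (suc j) + 2 * a j) * b 1                     ≤⟨ *-monoʳ-≤ (c (suc j)) (m≤m+n (b 1) (2 * a 0)) ⟩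
    (b (suc j) + 2 * a j) * (b 1 + 2 * a 0)         ∎
    where
    open ≤-Reasoning
    expand : ∀ x y z → (x + 2 * y) * (z + 0) ≡ x * z + 2 * (y * z)
    expand = solve-∀
    collect : ∀ x y z → x * z + 2 * (y * z) ≡ (x + 2 * y) * z
    collect = solve-∀
  lcʳ interlacing-step {suc i} {suc j} _ | inj₁ (s≤s i<j) = begin
    (b (2 + j) + 2 * a (suc j)) * (b (suc i) + 2 * a i)
      ≡⟨ expand (b (2 + j)) (a (suc j)) (b (suc i)) (a i) ⟩
    (b (2 + j) * b (suc i) + 4 * (a (suc j) * a i)) + 2 * (b (2 + j) * a i + a (suc j) * b (suc i))
      ≤⟨ +-mono-≤ (+-mono-≤ (lcʳ I (m≤n⇒m≤1+n i<j)) (*-monoʳ-≤ 4 (lcˡ I (<⇒≤ i<j))))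
           (*-monoʳ-≤ 2 (+-mono-≤ (b≼a I (m<n⇒m<1+n i<j)) (a≼b I i<j))) ⟩
    (b (suc j) * b (2 + i) + 4 * (a j * a (suc i))) + 2 * (b (suc j) * a (suc i) + a j * b (2 + i))
      ≡⟨ expand (b (suc j)) (a j) (b (2 + i)) (a (suc i)) ⟨
    (b (suc j) + 2 * a j) * (b (2 + i) + 2 * a (suc i)) ∎
    where
    open ≤-Reasoning
    expand : ∀ x y z w → (x + 2 * y) * (z + 2 * w) ≡ (x * z + 4 * (y * w)) + 2 * (x * w + y * z)
    expand = solve-∀

coeff-interlacing : ∀ n → Interlacing (coeff n) (coeff (suc n))
coeff-interlacing 0 = record
  { lcˡ = λ _ → z≤n
  ; lcʳ = λ { {j = 0} z≤n → ≤-refl ; {j = suc j} _ → z≤n }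
  ; a≼b = λ _ → z≤n
  ; b≼a = λ { {j = suc j} _ → z≤n }
  }
coeff-interlacing (suc n) = interlacing-step (coeff-interlacing n)

coeff-logConcave : ∀ n {i j} → i ≤ j → coeff n (suc j) * coeff n i ≤ coeff n j * coeff n (suc i)
coeff-logConcave n = lcˡ (coeff-interlacing n)

coeff-zero : ∀ n → coeff n 0 ≡ 1
coeff-zero 0             = refl
coeff-zero 1             = refl
coeff-zero (suc (suc n)) = trans (+-identityʳ (coeff (suc n) 0)) (coeff-zero (suc n))

coeff-vanishes : ∀ n {i} → ⌈ n /2⌉ < i → coeff n i ≡ 0
coeff-vanishes 0             {suc i} _         = refl
coeff-vanishes 1             {suc (suc i)} _   = refl
coeff-vanishes 1             {suc 0} (s≤s ())
coeff-vanishes (suc (suc n)) {suc i} (s≤s lt) = cong₂ (λ x y → x + 2 * y)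
  (coeff-vanishes (suc n) (s≤s (≤-trans (⌈n/2⌉-mono (n≤1+n (suc n))) lt))) (coeff-vanishes n lt)

coeff-top : ∀ n → 0 < coeff n ⌈ n /2⌉
coeff-top 0             = s≤s z≤n
coeff-top 1             = s≤s z≤n
coeff-top (suc (suc n)) = ≤-trans (coeff-top n) (≤-trans (m≤n*m (coeff n ⌈ n /2⌉) 2) (m≤n+m _ (coeff (suc n) (suc ⌈ n /2⌉))))

coeff-mono : ∀ n i → coeff n i ≤ coeff (suc n) i
coeff-mono 0       i = m≤m+n (coeff 0 i) _
coeff-mono (suc n) i = m≤m+n (coeff (suc n) i) _

-- The diagonal case of `a≼b`: the ratio of the coefficients i + 1 and i does not drop from Fₙ to
-- Fₙ₊₁. `fall-pred` reads the same inequality in the other direction.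
rise-suc : ∀ n i → coeff n i < coeff n (suc i) → coeff (suc n) i < coeff (suc n) (suc i)
rise-suc n i a<b = ≰⇒> λ β≤α → <-irrefl refl (begin-strict
  coeff n (suc i) * coeff (suc n) (suc i) ≤⟨ *-monoʳ-≤ (coeff n (suc i)) β≤α ⟩
  coeff n (suc i) * coeff (suc n) i       ≤⟨ a≼b (coeff-interlacing n) ≤-refl ⟩
  coeff n i * coeff (suc n) (suc i)       <⟨ *-monoˡ-< (coeff (suc n) (suc i)) {{β≢0}} a<b ⟩
  coeff n (suc i) * coeff (suc n) (suc i) ∎)
  where
  open ≤-Reasoning
  β≢0 = >-nonZero (≤-trans (≤-trans (s≤s z≤n) a<b) (coeff-mono n (suc i)))

fall-pred : ∀ n i → 0 < coeff n i → coeff (suc n) (suc i) < coeff (suc n) i → coeff n (suc i) < coeff n i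
fall-pred n i 0<a β<α = ≰⇒> λ a≤b → <-irrefl refl (begin-strict
  coeff n i * coeff (suc n) (suc i) <⟨ *-monoʳ-< (coeff n i) {{>-nonZero 0<a}} β<α ⟩
  coeff n i * coeff (suc n) i       ≤⟨ *-monoˡ-≤ (coeff (suc n) i) a≤b ⟩
  coeff n (suc i) * coeff (suc n) i ≤⟨ a≼b (coeff-interlacing n) ≤-refl ⟩
  coeff n i * coeff (suc n) (suc i) ∎)
  where open ≤-Reasoning

-- Binomial formula and the two comparisons of coefficients

C-pascal : ∀ n k → suc n choose suc k ≡ n choose k + n choose suc k
C-pascal n k = sym (nCk+nC[k+1]≡[n+1]C[k+1] n k)

C-sym : ∀ {n} k l → k + l ≡ n → n choose k ≡ n choose l
C-sym k l refl = trans (nCk≡nC[n∸k] (m≤m+n k l)) (cong ((k + l) choose_) (m+n∸m≡n k l))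

-- Pascal's rule adds two descents of the previous row. The second is strict; the first may straddle
-- the centre, where symmetry makes it an equality.
C-descending : ∀ n k → k ≤ n → n ≤ k + k → n choose suc k < n choose k
C-descending 0       0       _ _ = s≤s z≤n
C-descending (suc n) (suc k) (s≤s k≤n) (s≤s n≤2k+1) with m≤n⇒m<n∨m≡n k≤n
... | inj₂ refl = subst₂ _<_ (sym (k>n⇒nCk≡0 (n<1+n (suc n)))) (sym (nCn≡1 (suc n))) (s≤s z≤n)
... | inj₁ k<n  = begin-strict
  suc n choose (2 + k)             ≡⟨ C-pascal n (suc k) ⟩
  n choose suc k + n choose (2 + k)     <⟨ +-mono-≤-< weak
      (C-descending n (suc k) k<n (≤-trans n≤2k+1 (n≤1+n (k + suc k)))) ⟩
  n choose k + n choose suc k           ≡⟨ C-pascal n k ⟨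
  suc n choose suc k               ∎
  where
  open ≤-Reasoning
  weak : n choose suc k ≤ n choose k
  weak with m≤n⇒m<n∨m≡n n≤2k+1
  ... | inj₂ eq = ≤-reflexive (C-sym (suc k) k (trans (sym (+-suc k k)) (sym eq)))
  ... | inj₁ lt = <⇒≤ (C-descending n k k≤n (s≤s⁻¹ (≤-trans lt (≤-reflexive (+-suc k k)))))

-- This is 2i + 1 + j, where 2i + 1 is the first n for which Fₙ contains the power i + 1 of x. The
-- recursive form lets the recurrence for `coeff` unfold by computation.
index : ℕ → ℕ → ℕ
index 0       j = suc j
index (suc i) j = suc (suc (index i j))

index-suc : ∀ i j → index i (suc j) ≡ suc (index i j)
index-suc 0       j = refl
index-suc (suc i) j = cong (λ n → suc (suc n)) (index-suc i j)

index≡ : ∀ i j → index i j ≡ suc (i + i + j)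
index≡ 0       j = refl
index≡ (suc i) j rewrite index≡ i j | +-suc i i = refl

-- Fₙ is the mean of Gₙ and Gₙ₊₁, where Gₙ is the sum of C(n - k, k) (2x)ᵏ and satisfies the same
-- recurrence with G₀ = G₁ = 1. For k = i + 1 the halving turns 2ᵏ into 2ⁱ. The induction is
-- Pascal's rule.
coeff-closed : ∀ i j → coeff (index i j) (suc i) ≡ 2 ^ i * (suc (i + j) choose suc i + (i + j) choose suc i)
coeff-closed 0 0       = refl
coeff-closed 0 (suc j) = begin
  coeff (suc j) 1 + 2 * coeff j 0
    ≡⟨ cong₂ (λ x y → x + 2 * y) (coeff-closed 0 j) (coeff-zero j) ⟩
  1 * (suc j choose 1 + j choose 1) + 2
    ≡⟨ rearrange (suc j choose 1) (j choose 1) ⟩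
  1 * ((1 + suc j choose 1) + (1 + j choose 1))
    ≡⟨ cong₂ (λ x y → 1 * (x + y)) (C-pascal (suc j) 0) (C-pascal j 0) ⟨
  1 * ((2 + j) choose 1 + suc j choose 1) ∎
  where
  open ≡-Reasoning
  rearrange : ∀ x y → 1 * (x + y) + 2 ≡ 1 * ((1 + x) + (1 + y))
  rearrange = solve-∀
coeff-closed (suc i) j = begin
  coeff (suc (index i j)) (2 + i) + 2 * coeff (index i j) (suc i)
    ≡⟨ cong₂ (λ x y → x + 2 * y) (previous j) (coeff-closed i j) ⟩
  2 * 2ⁱ * (suc N choose (2 + i) + N choose (2 + i)) + 2 * (2ⁱ * (suc N choose suc i + N choose suc i))
    ≡⟨ rearrange 2ⁱ (suc N choose (2 + i)) (N choose (2 + i)) (suc N choose suc i) (N choose suc i) ⟩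
  2 * 2ⁱ * ((suc N choose suc i + suc N choose (2 + i)) + (N choose suc i + N choose (2 + i)))
    ≡⟨ cong₂ (λ x y → 2 * 2ⁱ * (x + y)) (C-pascal (suc N) (suc i)) (C-pascal N (suc i)) ⟨
  2 * 2ⁱ * ((2 + N) choose (2 + i) + suc N choose (2 + i)) ∎
  where
  open ≡-Reasoning
  2ⁱ = 2 ^ i
  N = i + j
  rearrange : ∀ p a b c d → 2 * p * (a + b) + 2 * (p * (c + d)) ≡ 2 * p * ((c + a) + (d + b))
  rearrange = solve-∀
  previous : ∀ j → coeff (suc (index i j)) (2 + i) ≡ 2 * 2ⁱ * (suc (i + j) choose (2 + i) + (i + j) choose (2 + i))
  -- The index is 2i + 2, where the degree is only i + 1: the coefficient and both binomials vanish.
  previous 0 = begin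
    coeff (suc (index i 0)) (2 + i) ≡⟨ coeff-vanishes (suc (index i 0)) (s≤s (≤-reflexive (⌈index/2⌉ i))) ⟩
    0                           ≡⟨ *-zeroʳ (2 * 2ⁱ) ⟨
    2 * 2ⁱ * 0                   ≡⟨ cong₂ (λ x y → 2 * 2ⁱ * (x + y)) (k>n⇒nCk≡0 (s≤s i+0<1+i)) (k>n⇒nCk≡0 (m<n⇒m<1+n i+0<1+i)) ⟨
    2 * 2ⁱ * (suc (i + 0) choose (2 + i) + (i + 0) choose (2 + i)) ∎
    where
    i+0<1+i : i + 0 < suc i
    i+0<1+i = s≤s (≤-reflexive (+-identityʳ i))
    ⌈index/2⌉ : ∀ i → ⌈ suc (index i 0) /2⌉ ≡ suc i
    ⌈index/2⌉ 0       = refl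
    ⌈index/2⌉ (suc i) = cong suc (⌈index/2⌉ i)
  previous (suc j) = begin
    coeff (suc (index i (suc j))) (2 + i)
      ≡⟨ cong (λ n → coeff (suc n) (2 + i)) (index-suc i j) ⟩
    coeff (index (suc i) j) (2 + i)
      ≡⟨ coeff-closed (suc i) j ⟩
    2 * 2ⁱ * (suc (suc i + j) choose (2 + i) + (suc i + j) choose (2 + i))
      ≡⟨ cong (λ n → 2 * 2ⁱ * (suc n choose (2 + i) + n choose (2 + i))) (+-suc i j) ⟨
    2 * 2ⁱ * (suc (i + suc j) choose (2 + i) + (i + suc j) choose (2 + i)) ∎

-- Both coefficients expand into entries of the row M = 2i + 2 and the next one. After symmetry and
-- cancellation there remains C(M + 1, i) < 2 C(M, i), that is, the ascent of row M just before i.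
rise-at : ∀ i → coeff (4 + i * 3) (1 + i) < coeff (4 + i * 3) (2 + i)
rise-at i = begin-strict
  coeff (4 + i * 3) (1 + i)
    ≡⟨ cong (λ n → coeff n (1 + i)) (trans (4+3i i) (sym (index≡ i (3 + i)))) ⟩
  coeff (index i (3 + i)) (1 + i)
    ≡⟨ coeff-closed i (3 + i) ⟩
  2ⁱ * (suc (i + (3 + i)) choose suc i + (i + (3 + i)) choose suc i)
    ≡⟨ cong (λ n → 2ⁱ * (suc n choose suc i + n choose suc i)) (2i+3 i) ⟩
  2ⁱ * ((2 + M) choose suc i + suc M choose suc i)
    ≡⟨ cong (λ x → 2ⁱ * (x + suc M choose suc i)) (C-pascal (suc M) i) ⟩
  2ⁱ * ((suc M choose i + suc M choose suc i) + suc M choose suc i)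
    ≡⟨ cong (λ x → 2ⁱ * ((suc M choose i + x) + x)) (C-pascal M i) ⟩
  2ⁱ * ((suc M choose i + (c₀ + c₁)) + (c₀ + c₁))
    <⟨ *-monoʳ-< 2ⁱ {{m^n≢0 2 i}} (+-monoˡ-< (c₀ + c₁) (+-monoˡ-< (c₀ + c₁) (key i))) ⟩
  2ⁱ * ((2 * c₀ + (c₀ + c₁)) + (c₀ + c₁))
    ≡⟨ rearrange 2ⁱ c₀ c₁ ⟩
  2 * 2ⁱ * ((c₁ + c₀) + c₀)
    ≡⟨ cong (λ x → 2 * 2ⁱ * ((c₁ + x) + x)) (C-sym i (2 + i) (2i+2 i)) ⟩
  2 * 2ⁱ * ((c₁ + M choose (2 + i)) + M choose (2 + i))
    ≡⟨ cong (λ x → 2 * 2ⁱ * (x + M choose (2 + i))) (C-pascal M (suc i)) ⟨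
  2 * 2ⁱ * (suc M choose (2 + i) + M choose (2 + i))
    ≡⟨ cong (λ n → 2 * 2ⁱ * (suc n choose (2 + i) + n choose (2 + i))) (cong suc (+-suc i i)) ⟨
  2 * 2ⁱ * (suc (suc i + suc i) choose (2 + i) + (suc i + suc i) choose (2 + i))
    ≡⟨ coeff-closed (suc i) (suc i) ⟨
  coeff (index (suc i) (suc i)) (2 + i)
    ≡⟨ cong (λ n → coeff n (2 + i)) (trans (4+3i′ i) (sym (index≡ (suc i) (suc i)))) ⟨
  coeff (4 + i * 3) (2 + i) ∎
  where
  open ≤-Reasoning
  2ⁱ = 2 ^ i
  M = 2 + (i + i)
  c₀ = M choose i
  c₁ = M choose suc i
  4+3i : ∀ i → 4 + i * 3 ≡ suc (i + i + (3 + i))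
  4+3i = solve-∀
  4+3i′ : ∀ i → 4 + i * 3 ≡ suc (suc i + suc i + suc i)
  4+3i′ = solve-∀
  2i+3 : ∀ i → i + (3 + i) ≡ 3 + (i + i)
  2i+3 = solve-∀
  2i+2 : ∀ i → i + (2 + i) ≡ 2 + (i + i)
  2i+2 = solve-∀
  rearrange : ∀ p y z → p * ((2 * y + (y + z)) + (y + z)) ≡ 2 * p * ((z + y) + y)
  rearrange = solve-∀
  key : ∀ i → suc (2 + (i + i)) choose i < 2 * ((2 + (i + i)) choose i)
  key 0       = s≤s (s≤s z≤n)
  -- `C-descending` concerns the right half of a row, so the ascent in the left half is reflected.
  key (suc m) = begin-strict
    suc N choose suc m           ≡⟨ C-pascal N m ⟩
    N choose m + N choose suc m       ≡⟨ cong₂ _+_ (C-sym m (4 + m) (outer m)) (C-sym (suc m) (3 + m) (inner m)) ⟩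
    N choose (4 + m) + N choose (3 + m) <⟨ +-monoˡ-< (N choose (3 + m)) (C-descending N (3 + m) (lower m) (upper m)) ⟩
    N choose (3 + m) + N choose (3 + m) ≡⟨ cong (N choose (3 + m) +_) (+-identityʳ (N choose (3 + m))) ⟨
    2 * (N choose (3 + m))       ≡⟨ cong (2 *_) (C-sym (suc m) (3 + m) (inner m)) ⟨
    2 * (N choose suc m)         ∎
    where
    N = 2 + (suc m + suc m)
    outer : ∀ m → m + (4 + m) ≡ 2 + (suc m + suc m)
    outer = solve-∀
    inner : ∀ m → suc m + (3 + m) ≡ 2 + (suc m + suc m)
    inner = solve-∀
    lower : ∀ m → 3 + m ≤ 2 + (suc m + suc m)
    lower m = s≤s (s≤s (s≤s (m≤m+n m (suc m))))
    upper : ∀ m → 2 + (suc m + suc m) ≤ (3 + m) + (3 + m)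
    upper m = ≤-trans (m≤n+m (2 + (suc m + suc m)) 2) (≤-reflexive (double m))
      where
      double : ∀ m → 2 + (2 + (suc m + suc m)) ≡ (3 + m) + (3 + m)
      double = solve-∀

-- In the row N = 2i + 1 the sides become 2ⁱ (2a + 4b) and 2ⁱ (5a + b), so the claim is 3b < 3a, a
-- descent just past the centre.
fall-at : ∀ i → coeff (3 + i * 3) (2 + i) < coeff (3 + i * 3) (1 + i)
fall-at i = begin-strict
  coeff (3 + i * 3) (2 + i)
    ≡⟨ cong (λ n → coeff n (2 + i)) (trans (3+3i′ i) (sym (index≡ (suc i) i))) ⟩
  coeff (index (suc i) i) (2 + i)
    ≡⟨ coeff-closed (suc i) i ⟩
  2 * 2ⁱ * (suc N choose (2 + i) + b)
    ≡⟨ cong (λ x → 2 * 2ⁱ * (x + b)) (C-pascal N (suc i)) ⟩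
  2 * 2ⁱ * ((a + b) + b)
    ≡⟨ split 2ⁱ a b ⟩
  2ⁱ * (3 * b + (b + 2 * a))
    <⟨ *-monoʳ-< 2ⁱ {{m^n≢0 2 i}} (+-monoˡ-< (b + 2 * a) (*-monoʳ-< 3
         (C-descending N (suc i) (s≤s (m≤m+n i i)) (s≤s (+-monoʳ-≤ i (n≤1+n i)))))) ⟩
  2ⁱ * (3 * a + (b + 2 * a))
    ≡⟨ rearrange 2ⁱ a b ⟩
  2ⁱ * (((a + b) + (a + a)) + (a + a))
    ≡⟨ cong (λ x → 2ⁱ * (((a + b) + (x + a)) + (x + a))) (C-sym i (suc i) (+-suc i i)) ⟨
  2ⁱ * (((a + b) + (N choose i + a)) + (N choose i + a))
    ≡⟨ cong (λ x → 2ⁱ * (((a + b) + x) + x)) (C-pascal N i) ⟨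
  2ⁱ * (((a + b) + suc N choose suc i) + suc N choose suc i)
    ≡⟨ cong (λ x → 2ⁱ * ((x + suc N choose suc i) + suc N choose suc i)) (C-pascal N (suc i)) ⟨
  2ⁱ * ((suc N choose (2 + i) + suc N choose suc i) + suc N choose suc i)
    ≡⟨ cong (λ x → 2ⁱ * ((x + suc N choose suc i) + suc N choose suc i)) (C-sym i (2 + i) (2i+2 i)) ⟨
  2ⁱ * ((suc N choose i + suc N choose suc i) + suc N choose suc i)
    ≡⟨ cong (λ x → 2ⁱ * (x + suc N choose suc i)) (C-pascal (suc N) i) ⟨
  2ⁱ * ((2 + N) choose suc i + suc N choose suc i)
    ≡⟨ cong (λ n → 2ⁱ * (suc n choose suc i + n choose suc i)) (2i+2 i) ⟨
  2ⁱ * (suc (i + (2 + i)) choose suc i + (i + (2 + i)) choose suc i)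
    ≡⟨ coeff-closed i (2 + i) ⟨
  coeff (index i (2 + i)) (1 + i)
    ≡⟨ cong (λ n → coeff n (1 + i)) (trans (3+3i i) (sym (index≡ i (2 + i)))) ⟨
  coeff (3 + i * 3) (1 + i) ∎
  where
  open ≤-Reasoning
  2ⁱ = 2 ^ i
  N = suc (i + i)
  a = N choose suc i
  b = N choose (2 + i)
  3+3i : ∀ i → 3 + i * 3 ≡ suc (i + i + (2 + i))
  3+3i = solve-∀
  3+3i′ : ∀ i → 3 + i * 3 ≡ suc (suc i + suc i + i)
  3+3i′ = solve-∀
  2i+2 : ∀ i → i + (2 + i) ≡ 2 + (i + i)
  2i+2 = solve-∀
  split : ∀ p a b → 2 * p * ((a + b) + b) ≡ p * (3 * b + (b + 2 * a))
  split = solve-∀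
  rearrange : ∀ p a b → p * (3 * a + (b + 2 * a)) ≡ p * (((a + b) + (a + a)) + (a + a))
  rearrange = solve-∀

-- Locating the peak

-- Only the neighbours of `p` are compared, log-concavity settling the rest. The form of `rise`
-- makes it vacuous at 0.
record Peak (f : ℕ → ℕ) (p : ℕ) : Set where
  field
    rise : ∀ {i} → suc i ≡ p → f i < f p
    fall : f (suc p) < f p

open Peak

coeff-peak-suc : ∀ n r → n ≢ 1 → ∀ ρ → ρ < 3 → n ≡ suc (ρ + r * 3) → Peak (coeff n) (suc r)
coeff-peak-suc n r n≢1 ρ ρ<3 refl = record
  { rise = λ { refl → rises ρ r n≢1 } ; fall = falls ρ ρ<3 n≢1 }
  where
  rises : ∀ ρ r → suc (ρ + r * 3) ≢ 1 → coeff (suc (ρ + r * 3)) r < coeff (suc (ρ + r * 3)) (suc r)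
  -- In the first block F₁ = 1 + x is a tie, so the rise starts from F₂ = 1 + 3x.
  rises 0             0       n≢1 = contradiction refl n≢1
  rises 0             (suc r) _   = rise-at r
  rises 1             0       _   = s≤s (s≤s z≤n)
  rises 1             (suc r) n≢1 = rise-suc (4 + r * 3) (suc r) (rise-at r)
  rises (suc (suc ρ)) r       n≢1 = rise-suc (2 + ρ + r * 3) r (rises (suc ρ) r (λ ()))
  positive : ∀ ρ → suc (ρ + r * 3) ≢ 1 → 0 < coeff (suc (ρ + r * 3)) (suc r)
  positive ρ n≢1 = ≤-trans (s≤s z≤n) (rises ρ r n≢1)
  falls : ∀ ρ → ρ < 3 → suc (ρ + r * 3) ≢ 1 → coeff (suc (ρ + r * 3)) (2 + r) < coeff (suc (ρ + r * 3)) (suc r)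
  falls 0 _ n≢1 = fall-pred (1 + r * 3) (suc r) (positive 0 n≢1) (falls 1 (s≤s (s≤s z≤n)) (λ ()))
  falls 1 _ n≢1 = fall-pred (2 + r * 3) (suc r) (positive 1 n≢1) (fall-at r)
  falls 2 _ _   = fall-at r
  falls (suc (suc (suc ρ))) (s≤s (s≤s (s≤s ())))

coeff-peak : ∀ n → n ≢ 1 → Peak (coeff n) ((n + 2) / 3)
coeff-peak n n≢1 with (n + 2) / 3 | (n + 2) % 3 | m≡m%n+[m/n]*n (n + 2) 3 | m%n<n (n + 2) 3
-- A quotient of 0 leaves only n = 0, where F₀ = 1.
... | 0     | ρ | eq | ρ<3 = subst (λ m → Peak (coeff m) 0) (sym n≡0) (record { rise = λ () ; fall = s≤s z≤n })
  where
  n≡0 : n ≡ 0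
  n≡0 = n≤0⇒n≡0 (+-cancelʳ-≤ 2 n 0 (≤-trans (≤-reflexive (trans eq (+-identityʳ ρ))) (s≤s⁻¹ ρ<3)))
... | suc r | ρ | eq | ρ<3 = coeff-peak-suc n r n≢1 ρ ρ<3
  (+-cancelʳ-≡ 2 n (suc (ρ + r * 3)) (trans eq (regroup ρ (r * 3))))
  where
  regroup : ∀ ρ t → ρ + (3 + t) ≡ suc (ρ + t) + 2
  regroup = solve-∀

module _ {f : ℕ → ℕ} (lc : ∀ {i j} → i ≤ j → f (suc j) * f i ≤ f j * f (suc i)) where
  -- Log-concavity compares the step at `i` with the strict step at `p`; the factor `f p`, positive
  -- because `f` falls after `p`, then cancels.
  unimodal : ∀ {p r} → Peak f p → p ≤ r → Unimodal f 0 p p r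
  unimodal {p} pk p≤r = record
    { q≤l     = z≤n
    ; l≤m     = ≤-refl
    ; m≤r     = p≤r
    ; rising  = λ i _ → rising p pk i
    ; ascent  = λ i _ i+1≡p → subst (λ q → f i < f q) (sym i+1≡p) (rise pk i+1≡p)
    ; plateau = λ i p≤i i<p → contradiction i<p (≤⇒≯ p≤i)
    ; descent = λ _ → fall pk
    ; falling = λ i p<i _ → *-cancelʳ-≤ (f (suc i)) (f i) (f p)
        {{>-nonZero (≤-trans (s≤s z≤n) (fall pk))}}
        (≤-trans (lc (<⇒≤ p<i)) (*-monoʳ-≤ (f i) (<⇒≤ (fall pk))))
    }
    where
    rising : ∀ p → Peak f p → ∀ i → suc i < p → f i ≤ f (suc i)
    rising (suc p) pk i (s≤s i<p) = *-cancelˡ-≤ (f (suc p)) {{>-nonZero (≤-trans (s≤s z≤n) (fall pk))}}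
      (≤-trans (lc (<⇒≤ i<p)) (*-monoˡ-≤ (f (suc i)) (<⇒≤ (rise pk refl))))

-- From coefficients to genus distributions

occurrences⁺ : ∀ i xs → i ∈ xs → 0 < occurrences i xs
occurrences⁺ i xs i∈ = filter-some (_≟ i) (Any.map sym i∈)

occurrences⁻ : ∀ i xs → 0 < occurrences i xs → i ∈ xs
occurrences⁻ i (x ∷ xs) pos with x ≟ i
... | yes x≡i = here (sym x≡i)
... | no  x≢i = there (occurrences⁻ i xs (subst (λ ys → 0 < length ys) (filter-reject (_≟ i) x≢i) pos))

module Distribution {S : List Word} {n c : ℕ} {{_ : NonZero c}}
  (distribution : ∀ i → #genus S i ≡ c * coeff n i) where

  private
    attained : ∀ i → 0 < coeff n i → i ∈ map genus S
    attained i 0<coeff = occurrences⁻ i (map genus S)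
      (subst (0 <_) (trans (sym (distribution i)) (#genus-occurrences S i))
        (≤-trans 0<coeff (m≤n*m (coeff n i) c)))

    bounded : ∀ {i} → i ∈ map genus S → i ≤ ⌈ n /2⌉
    bounded {i} i∈ = ≮⇒≥ λ top<i → <⇒≢ (occurrences⁺ i (map genus S) i∈) (sym (begin
      occurrences i (map genus S) ≡⟨ #genus-occurrences S i ⟨
      #genus S i                  ≡⟨ distribution i ⟩
      c * coeff n i                   ≡⟨ cong (c *_) (coeff-vanishes n top<i) ⟩
      c * 0                       ≡⟨ *-zeroʳ c ⟩
      0                           ∎))
      where open ≡-Reasoning

    minimum : IsMinimumGenus S 0
    minimum = attained 0 (≤-reflexive (sym (coeff-zero n))) , All.tabulate (λ _ → z≤n)

    maximum : IsMaximumGenus S ⌈ n /2⌉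
    maximum = attained ⌈ n /2⌉ (coeff-top n) , All.tabulate bounded

    lc : ∀ {i j} → i ≤ j → #genus S (suc j) * #genus S i ≤ #genus S j * #genus S (suc i)
    lc {i} {j} i≤j rewrite distribution i | distribution (suc i) | distribution j | distribution (suc j) =
      subst₂ _≤_ (square c (coeff n (suc j)) (coeff n i)) (square c (coeff n j) (coeff n (suc i)))
        (*-monoʳ-≤ (c * c) (coeff-logConcave n i≤j))
      where
      square : ∀ c x y → c * c * (x * y) ≡ c * x * (c * y)
      square = solve-∀

    scale-< : ∀ {i j} → coeff n i < coeff n j → #genus S i < #genus S j
    scale-< {i} {j} lt = subst₂ _<_ (sym (distribution i)) (sym (distribution j)) (*-monoʳ-< c lt)

  distribution-logConcave : GenusDistributionLogConcave S
  distribution-logConcave = 0 , ⌈ n /2⌉ , minimum , maximum , λ i _ _ →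
    ≤-trans (≤-reflexive (*-comm (#genus S i) (#genus S (2 + i)))) (lc (n≤1+n i))

  distribution-peak : ∀ {p} → Peak (coeff n) p → GenusDistributionPeak S p
  distribution-peak {p} pk = 0 , ⌈ n /2⌉ , minimum , maximum ,
    unimodal lc (record { rise = scale-< ∘ rise pk ; fall = scale-< (fall pk) })
      (bounded (attained p (≤-trans (s≤s z≤n) (fall pk))))

module distribution-S₆ (n : ℕ) = Distribution {S₆ n} {n} {2 ^ n} {{m^n≢0 2 n}} (#genus-S₆ n)
module distribution-S₁ (n : ℕ) = Distribution {S₁ (suc n)} {n} {4 * 2 ^ n} {{m*n≢0 4 (2 ^ n) {{_}} {{m^n≢0 2 n}}}} (#genus-S₁ n)

theorem3p2 : (∀ n → 1 ≤ n → GenusDistributionLogConcave (S₁ n)) ×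
    (∀ n → 1 ≤ n → GenusDistributionLogConcave (S₆ n)) ×
    (∀ n → 1 ≤ n → n ≢ 2 → GenusDistributionPeak (S₁ n) ((n + 1) / 3)) ×
    (∀ n → 2 ≤ n → GenusDistributionPeak (S₆ n) ((n + 2) / 3))
theorem3p2 =
  (λ { (suc n) _ → distribution-S₁.distribution-logConcave n }) ,
  (λ n _ → distribution-S₆.distribution-logConcave n) ,
  -- S₁ with n + 1 letters has the coefficients of Fₙ, so the peak is (n + 2) / 3 and the tie at F₁
  -- falls on two letters.
  (λ { (suc n) _ n+1≢2 → distribution-S₁.distribution-peak n
         (subst (λ m → Peak (coeff n) (m / 3)) (+-suc n 1) (coeff-peak n (n+1≢2 ∘ cong suc))) }) ,
  (λ n 2≤n → distribution-S₆.distribution-peak n (coeff-peak n (λ n≡1 → <⇒≢ 2≤n (sym n≡1))))
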